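{- For each integer $n\ge 2$ let $\varrho_e=\varrho_e(n)\in[0,1]$ and let $p_{i,j}=p_{i,j}(n)\in[0,1]$ for $\{i,j\}\in\binom{[n]}{2}$, with mean $\mu=\mu(n)$, and suppose there are constants $0<a\le b<1$ with $a\le\mu(n)\le b$ for all $n$. For each $n$, let $G=G_n$ and $H=H_n$ be $\varrho_e$-correlated random Bernoulli$(\{p_{i,j}\})$ graphs on the vertex set $[n]$, all defined on a common probability space, let $\mathcal I$ be the identity bijection of $[n]$, and let $\varrho_T=\varrho_T(n)$ be the total correlation. Then, as $n\to\infty$, $$\mathfrak{str}(G,H,\mathcal I)-\varrho_T\to 0\quad\text{almost surely}.$$
   Context: $[n]:=\{1,\dots,n\}$; $\binom{[n]}{2}$ is the set of all $2$-element subsets of $[n]$; $\Pi_n$ is the set of all bijections $[n]\to[n]$; $i\sim_G j$ means $i$ and $j$ are adjacent in $G$; $\mathbf 1(\cdot)$ is the indicator function. Graphs are simple and undirected. Correlated Bernoulli graphs: given $\varrho_e\in[0,1]$ (edge correlation) and numbers $p_{i,j}\in[0,1]$, $\{i,j\}\in\binom{[n]}{2}$ (Bernoulli parameters), not all $0$ and not all $1$, random graphs $G,H$ on vertex set $[n]$ are called $\varrho_e$-correlated random Bernoulli$(\{p_{i,j}\})$ graphs if for each $\{i,j\}\in\binom{[n]}{2}$ the variables $\mathbf 1(i\sim_G j)$ and $\mathbf 1(i\sim_H j)$ are each Bernoulli$(p_{i,j})$ and, if $0<p_{i,j}<1$, have Pearson correlation coefficient $\varrho_e$; other than these dependencies,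 the random variables $\{\mathbf 1(i\sim_G j)\}\cup\{\mathbf 1(i\sim_H j)\}$ are collectively independent (that is, the pairs $(\mathbf 1(i\sim_G j),\mathbf 1(i\sim_H j))$ are independent over $\{i,j\}\in\binom{[n]}{2}$). The mean and variance of the Bernoulli parameters are $\mu:=\binom n2^{ -1}\sum_{\{i,j\}\in\binom{[n]}{2}}p_{i,j}$ and $\sigma^2:=\binom n2^{ -1}\sum_{\{i,j\}\in\binom{[n]}{2}}(p_{i,j}-\mu)^2$. The heterogeneity correlation is $\varrho_h:=\dfrac{\sigma^2}{\mu(1-\mu)}$, and the total correlation $\varrho_T$ is defined by $1-\varrho_T:=(1-\varrho_e)(1-\varrho_h)$. For $\phi\in\Pi_n$, the number of disagreements between $G$ and $H$ under $\phi$ is $$d(G,H,\phi):=\sum_{\{i,j\}\in\binom{[n]}{2}}\mathbf 1\Big(\mathbf 1(i\sim_G j)\neq \mathbf 1(\phi(i)\sim_H\phi(j))\Big),$$ and the alignment strength of $\phi$ is $$\mathfrak{str}(G,H,\phi):=1-\frac{d(G,H,\phi)}{\frac1{n!}\sum_{\phi'\in\Pi_n}d(G,H,\phi')}.$$ The alignment strength is undefined when $G$ and $H$ are both edgeless or both complete; on that event assign it the value $0$ by convention. All parameters depend on $n$; no assumption is made on the dependence between the graph pairs for different values of $n$. -}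

module Defs where

open import Algebra.Bundles using (CommutativeRing)
open import Algebra.Definitions.RawMonoid using () renaming (_×_ to multiple)
open import Data.Bool using (Bool; true; false; _xor_; if_then_else_; T)
import Data.Bool.Properties as Bool
open import Data.Fin as Fin using (Fin; zero; suc)
import Data.Fin.Properties as Fin
open import Data.Fin.Permutation as Perm using (Permutation′; _⟨$⟩ʳ_; insert; remove)
open import Data.List using (List; []; _∷_; _++_; map; foldr; allFin; cartesianProduct; cartesianProductWith; length)
open import Data.List.Membership.Propositional.Properties using (∈-allFin)
open import Data.List.Properties using (length-++; length-map; length-tabulate)
open import Data.List.Relation.Unary.Any using (Any; here)
import Data.List.Relation.Unary.Any.Properties as Any
open import Data.Nat using (ℕ; zero; suc; _!; s<s; z<s)
open import Data.Nat.Combinatorics using (_C_)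
open import Data.Product using (Σ; ∃; ∃₂; _×_; _,_; <_,_>)
open import Data.Sum using (_⊎_)
open import Data.Unit.Polymorphic using (⊤)
open import Function using (id; _∘_; const)
open import Level using (Level; Lift) renaming (suc to lsuc)
open import Relation.Binary using (Rel; IsStrictTotalOrder)
import Relation.Binary.Construct.StrictToNonStrict as NonStrict
open import Relation.Binary.PropositionalEquality using (_≡_; _≢_; refl; trans; cong; cong₂)
open import Relation.Nullary using (¬_; Dec; does)
open import Relation.Nullary.Decidable using (_×-dec_; _⊎-dec_; _→-dec_; ¬?)
open import Relation.Unary using (Pred; ∁; ⋃; _≐_; _⊥_)

private
  variable
    ℓ : Level
    n : ℕ

-- The real numbers, up to isomorphism.  The inverse is total, its value at 0#
-- being the usual convention 0⁻¹ = 0.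
record CompleteOrderedField (ℓ : Level) : Set (lsuc ℓ) where
  infix  4 _<_ _≤_
  infixl 7 _/_
  infix  8 _⁻¹
  field
    commutativeRing : CommutativeRing ℓ ℓ
  open CommutativeRing commutativeRing public
    using (Carrier; _≈_; _+_; _*_; -_; _-_; 0#; 1#)
  field
    _<_                : Rel Carrier ℓ
    isStrictTotalOrder : IsStrictTotalOrder _≈_ _<_
    +-monoˡ-<          : ∀ z {x y} → x < y → (x + z) < (y + z)
    *-pos              : ∀ {x y} → 0# < x → 0# < y → 0# < (x * y)
    1≉0                : ¬ (1# ≈ 0#)
    _⁻¹                : Carrier → Carrier
    ⁻¹-cong            : ∀ {x y} → x ≈ y → (x ⁻¹) ≈ (y ⁻¹)
    ⁻¹-inverseʳ        : ∀ {x} → ¬ (x ≈ 0#) → (x * (x ⁻¹)) ≈ 1#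
    0⁻¹≈0              : (0# ⁻¹) ≈ 0#

  _≤_ : Rel Carrier ℓ
  _≤_ = NonStrict._≤_ _≈_ _<_

  IsUpperBound : Pred Carrier ℓ → Pred Carrier ℓ
  IsUpperBound S u = ∀ x → S x → x ≤ u

  field
    complete : (S : Pred Carrier ℓ) → ∃ S → ∃ (IsUpperBound S) →
               Σ Carrier λ s → IsUpperBound S s × (∀ u → IsUpperBound S u → s ≤ u)

  open IsStrictTotalOrder isStrictTotalOrder public using (_<?_)

  _/_ : Carrier → Carrier → Carrier
  x / y = x * (y ⁻¹)

  ∣_∣ : Carrier → Carrier
  ∣ x ∣ = if does (x <? 0#) then - x else x

  fromℕ : ℕ → Carrier
  fromℕ k = multiple (CommutativeRing.+-rawMonoid commutativeRing) k 1#

  𝟙 : Bool → Carrier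
  𝟙 b = if b then 1# else 0#

  sumOver : ∀ {a} {A : Set a} → List A → (A → Carrier) → Carrier
  sumOver xs f = foldr (λ x s → f x + s) 0# xs

  productOver : ∀ {a} {A : Set a} → List A → (A → Carrier) → Carrier
  productOver xs f = foldr (λ x s → f x * s) 1# xs

  partialSum : (ℕ → Carrier) → ℕ → Carrier
  partialSum x zero    = 0#
  partialSum x (suc k) = partialSum x k + x k

  _⟶_ : (ℕ → Carrier) → Carrier → Set ℓ
  x ⟶ L = ∀ ε → 0# < ε → Σ ℕ λ N → ∀ k → N Data.Nat.≤ k → ∣ x k - L ∣ < ε

-- The two-element subset {lo, hi}.
record Pair (n : ℕ) : Set where
  constructor pair
  field
    lo hi  : Fin n
    .lo<hi : lo Fin.< hi

open Pair public

pairs : ∀ n → List (Pair n)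
pairs zero    = []
pairs (suc n) = map (λ j → pair zero (suc j) z<s) (allFin n)
             ++ map (λ (pair i j i<j) → pair (suc i) (suc j) (s<s i<j)) (pairs n)

record SimpleGraph (n : ℕ) : Set where
  field
    adj       : Fin n → Fin n → Bool
    symmetric : ∀ i j → adj i j ≡ adj j i
    loopless  : ∀ i → adj i i ≡ false

open SimpleGraph public

edge : SimpleGraph n → Pair n → Bool
edge G e = adj G (lo e) (hi e)

Edgeless Complete : SimpleGraph n → Set
Edgeless G = ∀ i j → adj G i j ≡ false
Complete G = ∀ i j → i ≢ j → adj G i j ≡ true

edgeless? : (G : SimpleGraph n) → Dec (Edgeless G)
edgeless? G = Fin.all? λ i → Fin.all? λ j → adj G i j Bool.≟ false

complete? : (G : SimpleGraph n) → Dec (Complete G)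
complete? G = Fin.all? λ i → Fin.all? λ j → ¬? (i Fin.≟ j) →-dec (adj G i j Bool.≟ true)

-- All bijections of Fin n, each exactly once: choose the image j of zero, then
-- a bijection between the remaining points.
permutations : ∀ n → List (Permutation′ n)
permutations zero    = Perm.id ∷ []
permutations (suc n) = cartesianProductWith (insert zero) (allFin (suc n)) (permutations n)

-- Completeness of the enumeration together with its length n ! excludes repetitions.
permutations-complete : ∀ n (π : Permutation′ n) → Any (λ ρ → ρ Perm.≈ π) (permutations n)
permutations-complete zero    π = here (λ ())
permutations-complete (suc n) π =
  Any.cartesianProductWith⁺ (insert zero)
    (λ {j} {ρ} j≡ ρ≈ i → trans (agree j ρ j≡ ρ≈ i) (Perm.insert-remove zero π i))
    (∈-allFin (π ⟨$⟩ʳ zero)) (permutations-complete n (remove zero π))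
  where
  agree : ∀ j ρ → (π ⟨$⟩ʳ zero) ≡ j → ρ Perm.≈ remove zero π →
          insert zero j ρ Perm.≈ insert zero (π ⟨$⟩ʳ zero) (remove zero π)
  agree _ ρ refl ρ≈ zero    = refl
  agree _ ρ refl ρ≈ (suc i) = cong (Fin.punchIn (π ⟨$⟩ʳ zero)) (ρ≈ i)

permutations-length : ∀ n → length (permutations n) ≡ n !
permutations-length zero    = refl
permutations-length (suc n) =
  trans (product-length (allFin (suc n)) (permutations n))
        (cong₂ Data.Nat._*_ (length-tabulate {n = suc n} id) (permutations-length n))
  where
  product-length : ∀ {A B C : Set} {f : A → B → C} xs ys →
                   length (cartesianProductWith f xs ys) ≡ length xs Data.Nat.* length ys
  product-length []       ys = refl
  product-length {f = f} (x ∷ xs) ys =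
    trans (length-++ (map (f x) ys))
          (cong₂ Data.Nat._+_ (length-map (f x) ys) (product-length xs ys))

module Alignment (ℝ : CompleteOrderedField ℓ) where
  open CompleteOrderedField ℝ

  disagreements : SimpleGraph n → SimpleGraph n → Permutation′ n → Carrier
  disagreements {n} G H φ =
    sumOver (pairs n) λ e → 𝟙 (edge G e xor adj H (φ ⟨$⟩ʳ lo e) (φ ⟨$⟩ʳ hi e))

  averageDisagreements : SimpleGraph n → SimpleGraph n → Carrier
  averageDisagreements {n} G H =
    (1# / fromℕ (n !)) * sumOver (permutations n) (disagreements G H)

  degenerate? : (G H : SimpleGraph n) →
                Dec ((Edgeless G × Edgeless H) ⊎ (Complete G × Complete H))
  degenerate? G H = (edgeless? G ×-dec edgeless? H) ⊎-dec (complete? G ×-dec complete? H)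

  str : SimpleGraph n → SimpleGraph n → Permutation′ n → Carrier
  str G H φ = if does (degenerate? G H) then 0#
              else 1# - disagreements G H φ / averageDisagreements G H

  mean : (Pair n → Carrier) → Carrier
  mean {n} p = (1# / fromℕ (n C 2)) * sumOver (pairs n) p

  variance : (Pair n → Carrier) → Carrier
  variance {n} p =
    (1# / fromℕ (n C 2)) * sumOver (pairs n) λ e → (p e - mean p) * (p e - mean p)

  heterogeneity : (Pair n → Carrier) → Carrier
  heterogeneity p = variance p / (mean p * (1# - mean p))

  totalCorrelation : Carrier → (Pair n → Carrier) → Carrier
  totalCorrelation ϱₑ p = 1# - (1# - ϱₑ) * (1# - heterogeneity p)

-- ℙ is given on all predicates, but is only constrained (up to extensional
-- equality) on measurable ones.
record ProbabilitySpace (ℝ : CompleteOrderedField ℓ) : Set (lsuc (lsuc ℓ)) where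
  open CompleteOrderedField ℝ
  field
    Ω               : Set ℓ
    Measurable      : Pred Ω ℓ → Set (lsuc ℓ)
    Measurable-resp : ∀ {A B} → A ≐ B → Measurable A → Measurable B
    Measurable-Ω    : Measurable (const ⊤)
    Measurable-∁    : ∀ {A} → Measurable A → Measurable (∁ A)
    Measurable-⋃    : ∀ (A : ℕ → Pred Ω ℓ) → (∀ k → Measurable (A k)) → Measurable (⋃ ℕ A)
    ℙ               : Pred Ω ℓ → Carrier
    ℙ-cong          : ∀ {A B} → A ≐ B → ℙ A ≈ ℙ B
    ℙ-nonneg        : ∀ {A} → Measurable A → 0# ≤ ℙ A
    ℙ-Ω             : ℙ (const ⊤) ≈ 1#
    ℙ-⋃             : ∀ (A : ℕ → Pred Ω ℓ) → (∀ k → Measurable (A k)) →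
                      (∀ {k m} → k ≢ m → A k ⊥ A m) →
                      partialSum (ℙ ∘ A) ⟶ ℙ (⋃ ℕ A)

module Probability {ℝ : CompleteOrderedField ℓ} (𝒫 : ProbabilitySpace ℝ) where
  open CompleteOrderedField ℝ
  open ProbabilitySpace 𝒫

  AlmostSurely : Pred Ω ℓ → Set (lsuc ℓ)
  AlmostSurely A =
    Σ (Pred Ω ℓ) λ N → Measurable N × ℙ N ≈ 0# × (∀ ω → ¬ N ω → A ω)

  ⟦_≔_⟧ : {A : Set} → (Ω → A) → A → Pred Ω ℓ
  ⟦ X ≔ a ⟧ ω = Lift ℓ (X ω ≡ a)

  IsDiscreteRandomVariable : {A : Set} → (Ω → A) → Set (lsuc ℓ)
  IsDiscreteRandomVariable X = ∀ a → Measurable ⟦ X ≔ a ⟧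

  -- The expectation of f(X), where vs lists the possible values of X.
  𝔼 : {A : Set} → List A → (Ω → A) → (A → Carrier) → Carrier
  𝔼 vs X f = sumOver vs λ a → f a * ℙ ⟦ X ≔ a ⟧

  bits : List Bool
  bits = false ∷ true ∷ []

  𝔼[_] : (Ω → Bool) → Carrier
  𝔼[ X ] = 𝔼 bits X 𝟙

  Var : (Ω → Bool) → Carrier
  Var X = 𝔼 bits X λ x → (𝟙 x - 𝔼[ X ]) * (𝟙 x - 𝔼[ X ])

  Cov : (Ω → Bool) → (Ω → Bool) → Carrier
  Cov X Y = 𝔼 (cartesianProduct bits bits) < X , Y > λ (x , y) →
              (𝟙 x - 𝔼[ X ]) * (𝟙 y - 𝔼[ Y ])

  IsStandardDeviation : (Ω → Bool) → Carrier → Set ℓ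
  IsStandardDeviation X s = 0# ≤ s × (s * s) ≈ Var X

  HasPearsonCorrelation : (Ω → Bool) → (Ω → Bool) → Carrier → Set ℓ
  HasPearsonCorrelation X Y ϱ =
    ∃₂ λ s t → IsStandardDeviation X s × IsStandardDeviation Y t × ϱ ≈ (Cov X Y / (s * t))

  IsBernoulli : Carrier → (Ω → Bool) → Set ℓ
  IsBernoulli p X = ℙ ⟦ X ≔ true ⟧ ≈ p

  -- Subfamilies are covered by letting B e be constantly true.
  Independent : {A : Set} → (Pair n → Ω → A) → Set ℓ
  Independent {n} {A} X = (B : Pair n → A → Bool) →
    ℙ (λ ω → ∀ e → Lift ℓ (T (B e (X e ω))))
      ≈ productOver (pairs n) λ e → ℙ (λ ω → Lift ℓ (T (B e (X e ω))))

  randomEdge : (Ω → SimpleGraph n) → Pair n → Ω → Bool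
  randomEdge G e ω = edge (G ω) e

  record CorrelatedBernoulliGraphs (ϱₑ : Carrier) (p : Pair n → Carrier)
                                   (G H : Ω → SimpleGraph n) : Set (lsuc ℓ) where
    field
      0≤ϱₑ         : 0# ≤ ϱₑ
      ϱₑ≤1         : ϱₑ ≤ 1#
      0≤p          : ∀ e → 0# ≤ p e
      p≤1          : ∀ e → p e ≤ 1#
      not-all-0    : ¬ (∀ e → p e ≈ 0#)
      not-all-1    : ¬ (∀ e → p e ≈ 1#)
      G-measurable : ∀ e → IsDiscreteRandomVariable (randomEdge G e)
      H-measurable : ∀ e → IsDiscreteRandomVariable (randomEdge H e)
      G-bernoulli  : ∀ e → IsBernoulli (p e) (randomEdge G e)
      H-bernoulli  : ∀ e → IsBernoulli (p e) (randomEdge H e)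
      correlated   : ∀ e → 0# < p e → p e < 1# →
                     HasPearsonCorrelation (randomEdge G e) (randomEdge H e) ϱₑ
      independent  : Independent (λ e → < randomEdge G e , randomEdge H e >)

{-# OPTIONS --safe #-}
module Submission where

-- Write N for the number of pairs, and x, y, z for the proportions of pairs that are edges of G, edges
-- of H, and disagreements under the identity.  A uniformly random bijection sends each pair to a
-- uniformly random pair, so the average number of disagreements is N (x + y − 2xy) and the alignment
-- strength is 1 − z / (x + y − 2xy).  The means of x, y and z are μ, μ and
-- 2 (1 − ϱₑ) avg p(1 − p) = 2 μ(1 − μ) (1 − ϱ_T).  Each of x, y, z is an average of N independent
-- indicators, so by Chebyshev's inequality it is at least δ away from its mean with probability at most
-- 1 / (δ² N) = 2 / (δ² n(n − 1)).  This is summable in n, whence almost sure convergence by Borel–Cantelli.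

open import Algebra.Bundles using (CommutativeRing)
import Algebra.Properties.Ring
import Algebra.Properties.Semiring.Mult
import Algebra.Properties.Semiring.Mult.TCOptimised
import Algebra.Properties.Semiring.Sum
import Algebra.Solver.Ring
open import Algebra.Solver.Ring.AlmostCommutativeRing
  using (_-Raw-AlmostCommutative⟶_; Induced-equivalence; fromCommutativeRing)
open import Axiom.DoubleNegationElimination using (em⇒dne)
open import Axiom.ExcludedMiddle using (ExcludedMiddle)
open import Data.Bool using (Bool; true; false; if_then_else_; T; _xor_)
import Data.Bool.Properties as Bool
open import Data.Empty using (⊥-elim; ⊥-elim-irr)
open import Data.Fin as Fin using (Fin; zero; suc)
open import Data.Fin.Permutation using (_⟨$⟩ʳ_; insert; id)
import Data.Fin.Properties as Fin
open import Data.Integer as ℤ using (ℤ; +_; -[1+_])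
import Data.Integer.Properties as ℤ
open import Data.List using (List; []; _∷_; _++_; map; tabulate; allFin; length; cartesianProductWith)
open import Data.List.Membership.Propositional using (_∈_)
open import Data.List.Membership.Propositional.Properties using (∈-map⁻)
import Data.List.Properties as List
open import Data.List.Relation.Unary.All as All using (All; []; _∷_)
open import Data.List.Relation.Unary.AllPairs using ([]; _∷_)
open import Data.List.Relation.Unary.Any using (here; there)
open import Data.List.Relation.Unary.Unique.Propositional using (Unique)
import Data.List.Relation.Unary.Unique.Propositional.Properties as Unique
import Data.Maybe as Maybe
open import Data.Nat as ℕ using (ℕ; zero; suc; _!) renaming (_≤_ to _≤ℕ_)
open import Data.Nat.Combinatorics using (_C_; nC1≡n; nCk+nC[k+1]≡[n+1]C[k+1])
import Data.Nat.Properties as ℕ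
import Data.Nat.Tactic.RingSolver as ℕSolver
open import Data.Product using (Σ; ∃; _×_; _,_; proj₁; proj₂; <_,_>; swap)
open import Data.Sum using (_⊎_; inj₁; inj₂; [_,_]′)
open import Data.Unit.Polymorphic using (⊤; tt)
open import Function using (_∘_; const)
open import Level using (Lift; lift; lower)
open import Relation.Binary.Bundles using (StrictTotalOrder)
open import Relation.Binary.Definitions using (WeaklyDecidable; tri<; tri≈; tri>)
import Relation.Binary.Properties.StrictTotalOrder
open import Relation.Binary.PropositionalEquality as ≡ using (_≡_; _≢_)
import Relation.Binary.Reasoning.StrictPartialOrder
open import Relation.Nullary using (¬_; Dec; yes; no; does; contradiction)
open import Relation.Nullary.Decidable using (dec⇒maybe; map′; _×-dec_; dec-true; dec-false)
open import Relation.Unary using (Pred; ∁; ⋃; ⋂; _∩_; _∪_; _≐_; _⊆_; _⊥_)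
open import Defs

-- Continuity of division is avoided. With D = x + y - 2xy, M = μ(1 - μ) and w the mean of z, the
-- error satisfies D (str - ϱ_T) = (D - 2M)(1 - ϱ_T) - (z - w). Once x, y, z are close to their
-- means, both terms on the right are small, and D is at least a(1 - b), a bound free of n; this is
-- where the bounds on μ enter. A probability space supplies measures of events but no integral.
-- Chebyshev's inequality is therefore proved by revealing the indicators one pair at a time,
-- carrying the event revealed so far and the accumulated deviation; the product form of
-- independence is recast in this sequential form. Second moments suffice because the number of
-- pairs is quadratic in n. Borel-Cantelli only adds probabilities, so graphs of different sizes may
-- depend on each other in any way.

-- The solver takes integer coefficients since those of an abstract ring do not compute.  With the
-- optimised multiple, the coefficients 0, 1 and 2 denote 0#, 1# and 1# + 1# definitionally.
module IntegerCoefficientSolver {c ℓ} (R : CommutativeRing c ℓ) where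
  open CommutativeRing R
  open Algebra.Properties.Ring ring
    using (-0#≈0#; -‿involutive; -‿distribˡ-*; -‿distribʳ-*; -‿+-comm)
  open Algebra.Properties.Semiring.Mult.TCOptimised semiring
    using (×-homo-+; ×1-homo-*) renaming (_×_ to _×′_)
  open import Relation.Binary.Reasoning.Setoid setoid

  fromℤ : ℤ → Carrier
  fromℤ (+ n)    = n ×′ 1#
  fromℤ -[1+ n ] = - (suc n ×′ 1#)

  fromℤ-neg : ∀ i → fromℤ (ℤ.- i) ≈ - fromℤ i
  fromℤ-neg (+ zero)  = sym -0#≈0#
  fromℤ-neg (+ suc n) = refl
  fromℤ-neg -[1+ n ]  = sym (-‿involutive _)

  private
    x+y-[x+z] : ∀ x y z → (x + y) - (x + z) ≈ y - z
    x+y-[x+z] x y z = begin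
      (x + y) - (x + z)     ≈⟨ +-cong (+-comm x y) (sym (-‿+-comm x z)) ⟩
      (y + x) + (- x - z)   ≈⟨ +-assoc y x _ ⟩
      y + (x + (- x - z))   ≈⟨ +-congˡ (+-assoc x (- x) _) ⟨
      y + ((x - x) - z)     ≈⟨ +-congˡ (+-congʳ (-‿inverseʳ x)) ⟩
      y + (0# - z)          ≈⟨ +-congˡ (+-identityˡ _) ⟩
      y - z                 ∎

  fromℤ-⊖ : ∀ m n → fromℤ (m ℤ.⊖ n) ≈ m ×′ 1# - n ×′ 1#
  fromℤ-⊖ zero    zero    = sym (-‿inverseʳ 0#)
  fromℤ-⊖ zero    (suc n) = sym (+-identityˡ _)
  fromℤ-⊖ (suc m) zero    = sym (trans (+-congˡ -0#≈0#) (+-identityʳ _))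
  fromℤ-⊖ (suc m) (suc n) = begin
    fromℤ (suc m ℤ.⊖ suc n)               ≡⟨ ≡.cong fromℤ (ℤ.[1+m]⊖[1+n]≡m⊖n m n) ⟩
    fromℤ (m ℤ.⊖ n)                       ≈⟨ fromℤ-⊖ m n ⟩
    m ×′ 1# - n ×′ 1#                     ≈⟨ x+y-[x+z] 1# _ _ ⟨
    (1# + m ×′ 1#) - (1# + n ×′ 1#)       ≈⟨ +-cong (×-homo-+ 1# 1 m) (-‿cong (×-homo-+ 1# 1 n)) ⟨
    suc m ×′ 1# - suc n ×′ 1#             ∎

  fromℤ-+ : ∀ i j → fromℤ (i ℤ.+ j) ≈ fromℤ i + fromℤ j
  fromℤ-+ (+ m)    (+ n)    = ×-homo-+ 1# m n
  fromℤ-+ (+ m)    -[1+ n ] = fromℤ-⊖ m (suc n)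
  fromℤ-+ -[1+ m ] (+ n)    = trans (fromℤ-⊖ n (suc m)) (+-comm _ _)
  fromℤ-+ -[1+ m ] -[1+ n ] = begin
    - (suc (suc (m ℕ.+ n)) ×′ 1#)         ≡⟨ ≡.cong (λ k → - (k ×′ 1#)) (ℕ.+-suc (suc m) n) ⟨
    - ((suc m ℕ.+ suc n) ×′ 1#)           ≈⟨ -‿cong (×-homo-+ 1# (suc m) (suc n)) ⟩
    - (suc m ×′ 1# + suc n ×′ 1#)         ≈⟨ -‿+-comm _ _ ⟨
    - (suc m ×′ 1#) - (suc n ×′ 1#)       ∎

  fromℤ-* : ∀ i j → fromℤ (i ℤ.* j) ≈ fromℤ i * fromℤ j
  fromℤ-* (+ m)    (+ n)    = begin
    fromℤ (+ m ℤ.* + n)                   ≡⟨ ≡.cong fromℤ (ℤ.+◃n≡+n (m ℕ.* n)) ⟩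
    (m ℕ.* n) ×′ 1#                       ≈⟨ ×1-homo-* m n ⟩
    fromℤ (+ m) * fromℤ (+ n)             ∎
  fromℤ-* (+ m)    -[1+ n ] = begin
    fromℤ (+ m ℤ.* -[1+ n ])              ≡⟨ ≡.cong fromℤ (ℤ.-◃n≡-n (m ℕ.* suc n)) ⟩
    fromℤ (ℤ.- (+ (m ℕ.* suc n)))         ≈⟨ fromℤ-neg (+ (m ℕ.* suc n)) ⟩
    - ((m ℕ.* suc n) ×′ 1#)               ≈⟨ -‿cong (×1-homo-* m (suc n)) ⟩
    - (m ×′ 1# * (suc n ×′ 1#))           ≈⟨ -‿distribʳ-* _ _ ⟩
    m ×′ 1# * - (suc n ×′ 1#)             ∎
  fromℤ-* -[1+ m ] (+ n)    = begin
    fromℤ (-[1+ m ] ℤ.* + n)              ≡⟨ ≡.cong fromℤ (ℤ.-◃n≡-n (suc m ℕ.* n)) ⟩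
    fromℤ (ℤ.- (+ (suc m ℕ.* n)))         ≈⟨ fromℤ-neg (+ (suc m ℕ.* n)) ⟩
    - ((suc m ℕ.* n) ×′ 1#)               ≈⟨ -‿cong (×1-homo-* (suc m) n) ⟩
    - (suc m ×′ 1# * (n ×′ 1#))           ≈⟨ -‿distribˡ-* _ _ ⟩
    - (suc m ×′ 1#) * (n ×′ 1#)           ∎
  fromℤ-* -[1+ m ] -[1+ n ] = begin
    fromℤ (-[1+ m ] ℤ.* -[1+ n ])         ≈⟨ ×1-homo-* (suc m) (suc n) ⟩
    suc m ×′ 1# * (suc n ×′ 1#)           ≈⟨ -‿involutive _ ⟨
    - - (suc m ×′ 1# * (suc n ×′ 1#))     ≈⟨ -‿cong (-‿distribˡ-* _ _) ⟩
    - (- (suc m ×′ 1#) * (suc n ×′ 1#))   ≈⟨ -‿distribʳ-* _ _ ⟩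
    - (suc m ×′ 1#) * - (suc n ×′ 1#)     ∎

  private
    morphism : ℤ.+-*-rawRing -Raw-AlmostCommutative⟶ fromCommutativeRing R
    morphism = record
      { ⟦_⟧ = fromℤ ; +-homo = fromℤ-+ ; *-homo = fromℤ-* ; -‿homo = fromℤ-neg
      ; 0-homo = refl ; 1-homo = refl }

    _coeff≟_ : WeaklyDecidable (Induced-equivalence morphism)
    i coeff≟ j = Maybe.map (λ i≡j → reflexive (≡.cong fromℤ i≡j)) (dec⇒maybe (i ℤ.≟ j))

  open Algebra.Solver.Ring ℤ.+-*-rawRing (fromCommutativeRing R) morphism _coeff≟_ public
    using (solve; con; _:+_; _:*_; _:-_; :-_; _:=_)

-- Order, absolute value and limits in a complete ordered field.

module RealNumbers {ℓ} (ℝ : CompleteOrderedField ℓ) where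
  open CompleteOrderedField ℝ
  open CommutativeRing commutativeRing public
    using ( semiring; setoid; reflexive; +-cong; +-congˡ; +-congʳ; *-cong; *-congˡ; *-congʳ; -‿cong
          ; +-identityˡ; +-identityʳ; *-identityˡ; zeroˡ; zeroʳ; -‿inverseʳ; +-comm; *-comm
          ; +-assoc; *-assoc; distribˡ )
    renaming (refl to ≈-refl; sym to ≈-sym; trans to ≈-trans)
  open IntegerCoefficientSolver commutativeRing public
  open Algebra.Properties.Semiring.Mult semiring using (×1-homo-*)

  private
    strictTotalOrder : StrictTotalOrder ℓ ℓ ℓ
    strictTotalOrder = record { isStrictTotalOrder = isStrictTotalOrder }

  open StrictTotalOrder strictTotalOrder public
    using (compare; <-respˡ-≈; <-respʳ-≈; strictPartialOrder)
    renaming (irrefl to <-irrefl; trans to <-trans)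
  open Relation.Binary.Properties.StrictTotalOrder strictTotalOrder public
    using (_≤?_; ≤-respˡ-≈; ≤-respʳ-≈)
    renaming (refl to ≤-refl; reflexive to ≤-reflexive; trans to ≤-trans; antisym to ≤-antisym
             ; total to ≤-total)
  module ≤-Reasoning = Relation.Binary.Reasoning.StrictPartialOrder strictPartialOrder

  <⇒≤ : ∀ {x y} → x < y → x ≤ y
  <⇒≤ = inj₁

  <-≤-trans : ∀ {x y z} → x < y → y ≤ z → x < z
  <-≤-trans x<y (inj₁ y<z) = <-trans x<y y<z
  <-≤-trans x<y (inj₂ y≈z) = <-respʳ-≈ y≈z x<y

  ≤-<-trans : ∀ {x y z} → x ≤ y → y < z → x < z
  ≤-<-trans (inj₁ x<y) y<z = <-trans x<y y<z
  ≤-<-trans (inj₂ x≈y) y<z = <-respˡ-≈ (≈-sym x≈y) y<z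

  ≤⇒≯ : ∀ {x y} → x ≤ y → ¬ (y < x)
  ≤⇒≯ x≤y y<x = <-irrefl ≈-refl (≤-<-trans x≤y y<x)

  ≮⇒≥ : ∀ {x y} → ¬ (x < y) → y ≤ x
  ≮⇒≥ {x} {y} x≮y with compare x y
  ... | tri< x<y _ _ = contradiction x<y x≮y
  ... | tri≈ _ x≈y _ = inj₂ (≈-sym x≈y)
  ... | tri> _ _ y<x = inj₁ y<x

  ≰⇒> : ∀ {x y} → ¬ (x ≤ y) → y < x
  ≰⇒> {x} {y} x≰y with compare x y
  ... | tri< x<y _ _ = contradiction (inj₁ x<y) x≰y
  ... | tri≈ _ x≈y _ = contradiction (inj₂ x≈y) x≰y
  ... | tri> _ _ y<x = y<x

  -- The standard form of the polynomial inequalities below: a difference `d` whose sign is visible,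
  -- and a ring identity left to the solver.
  <-by-difference : ∀ {x y d} → 0# < d → d ≈ y - x → x < y
  <-by-difference {x} {y} {d} 0<d d≈ = <-respˡ-≈ (+-identityˡ x) (<-respʳ-≈
    (≈-trans (+-congʳ d≈) (solve 2 (λ x y → (y :- x) :+ x := y) ≈-refl x y)) (+-monoˡ-< x 0<d))

  ≤-by-difference : ∀ {x y d} → 0# ≤ d → d ≈ y - x → x ≤ y
  ≤-by-difference (inj₁ 0<d) d≈ = inj₁ (<-by-difference 0<d d≈)
  ≤-by-difference {x} {y} (inj₂ 0≈d) d≈ = inj₂ (≈-trans (≈-sym (+-identityˡ x)) (≈-trans
    (+-congʳ (≈-trans 0≈d d≈)) (solve 2 (λ x y → (y :- x) :+ x := y) ≈-refl x y)))

  x<y⇒0<y-x : ∀ {x y} → x < y → 0# < y - x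
  x<y⇒0<y-x {x} x<y = <-respˡ-≈ (-‿inverseʳ x) (+-monoˡ-< (- x) x<y)

  x≤y⇒0≤y-x : ∀ {x y} → x ≤ y → 0# ≤ y - x
  x≤y⇒0≤y-x (inj₁ x<y) = inj₁ (x<y⇒0<y-x x<y)
  x≤y⇒0≤y-x {x} (inj₂ x≈y) = inj₂ (≈-trans (≈-sym (-‿inverseʳ x)) (+-congʳ x≈y))

  x-0≈x : ∀ x → x - 0# ≈ x
  x-0≈x = solve 1 (λ x → x :- con (+ 0) := x) ≈-refl

  0<x+y : ∀ {x y} → 0# < x → 0# ≤ y → 0# < x + y
  0<x+y {x} {y} 0<x 0≤y =
    ≤-<-trans 0≤y (<-by-difference 0<x (solve 2 (λ x y → x := (x :+ y) :- y) ≈-refl x y))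

  0≤x+y : ∀ {x y} → 0# ≤ x → 0# ≤ y → 0# ≤ x + y
  0≤x+y {x} {y} 0≤x 0≤y =
    ≤-trans 0≤y (≤-by-difference 0≤x (solve 2 (λ x y → x := (x :+ y) :- y) ≈-refl x y))

  +-mono-≤ : ∀ {x y u v} → x ≤ y → u ≤ v → x + u ≤ y + v
  +-mono-≤ {x} {y} {u} {v} x≤y u≤v = ≤-by-difference (0≤x+y (x≤y⇒0≤y-x x≤y) (x≤y⇒0≤y-x u≤v))
    (solve 4 (λ x y u v → (y :- x) :+ (v :- u) := (y :+ v) :- (x :+ u)) ≈-refl x y u v)

  0≤x*y : ∀ {x y} → 0# ≤ x → 0# ≤ y → 0# ≤ x * y
  0≤x*y (inj₁ 0<x) (inj₁ 0<y) = inj₁ (*-pos 0<x 0<y)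
  0≤x*y {x} {y} (inj₂ 0≈x) _ = inj₂ (≈-trans (≈-sym (zeroˡ y)) (*-congʳ 0≈x))
  0≤x*y {x} {y} _ (inj₂ 0≈y) = inj₂ (≈-trans (≈-sym (zeroʳ x)) (*-congˡ 0≈y))

  *-monoʳ-≤ : ∀ {x y z} → 0# ≤ z → x ≤ y → z * x ≤ z * y
  *-monoʳ-≤ {x} {y} {z} 0≤z x≤y = ≤-by-difference (0≤x*y 0≤z (x≤y⇒0≤y-x x≤y))
    (solve 3 (λ x y z → z :* (y :- x) := z :* y :- z :* x) ≈-refl x y z)

  *-monoʳ-< : ∀ {x y z} → 0# < z → x < y → z * x < z * y
  *-monoʳ-< {x} {y} {z} 0<z x<y = <-by-difference (*-pos 0<z (x<y⇒0<y-x x<y))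
    (solve 3 (λ x y z → z :* (y :- x) := z :* y :- z :* x) ≈-refl x y z)

  *-cancelˡ-≤ : ∀ {x y z} → 0# < z → z * x ≤ z * y → x ≤ y
  *-cancelˡ-≤ 0<z zx≤zy = ≮⇒≥ λ y<x → ≤⇒≯ zx≤zy (*-monoʳ-< 0<z y<x)

  *-cancelˡ-< : ∀ {x y z} → 0# < z → z * x < z * y → x < y
  *-cancelˡ-< 0<z zx<zy = ≰⇒> λ y≤x → ≤⇒≯ (*-monoʳ-≤ (<⇒≤ 0<z) y≤x) zx<zy

  *-cancelˡ : ∀ {x y z} → 0# < z → z * x ≈ z * y → x ≈ y
  *-cancelˡ 0<z zx≈zy =
    ≤-antisym (*-cancelˡ-≤ 0<z (≤-reflexive zx≈zy)) (*-cancelˡ-≤ 0<z (≤-reflexive (≈-sym zx≈zy)))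

  x<0⇒0<-x : ∀ {x} → x < 0# → 0# < - x
  x<0⇒0<-x {x} x<0 = <-respʳ-≈ (+-identityˡ (- x)) (x<y⇒0<y-x x<0)

  0≤x² : ∀ x → 0# ≤ x * x
  0≤x² x with compare x 0#
  ... | tri< x<0 _ _ = <⇒≤ (<-respʳ-≈ (solve 1 (λ x → :- x :* :- x := x :* x) ≈-refl x)
                                      (*-pos (x<0⇒0<-x x<0) (x<0⇒0<-x x<0)))
  ... | tri≈ _ x≈0 _ = inj₂ (≈-sym (≈-trans (*-congʳ x≈0) (zeroˡ x)))
  ... | tri> _ _ 0<x = <⇒≤ (*-pos 0<x 0<x)

  0<1 : 0# < 1#
  0<1 with 0≤x² 1#
  ... | inj₁ 0<1*1 = <-respʳ-≈ (*-identityˡ 1#) 0<1*1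
  ... | inj₂ 0≈1*1 = contradiction (≈-sym (≈-trans 0≈1*1 (*-identityˡ 1#))) 1≉0

  <⇒≉ : ∀ {x y} → x < y → ¬ (y ≈ x)
  <⇒≉ x<y y≈x = <-irrefl (≈-sym y≈x) x<y

  x*x⁻¹≈1 : ∀ {x} → 0# < x → x * x ⁻¹ ≈ 1#
  x*x⁻¹≈1 0<x = ⁻¹-inverseʳ (<⇒≉ 0<x)

  0<x⁻¹ : ∀ {x} → 0# < x → 0# < x ⁻¹
  0<x⁻¹ {x} 0<x = *-cancelˡ-< 0<x (<-respˡ-≈ (≈-sym (zeroʳ x)) (<-respʳ-≈ (≈-sym (x*x⁻¹≈1 0<x)) 0<1))

  x*[1/x*y]≈y : ∀ {x} y → 0# < x → x * (1# / x * y) ≈ y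
  x*[1/x*y]≈y {x} y 0<x = begin
    x * (1# / x * y)   ≈⟨ solve 3 (λ x i y → x :* (con (+ 1) :* i :* y) := (x :* i) :* y) ≈-refl x (x ⁻¹) y ⟩
    x * x ⁻¹ * y       ≈⟨ *-congʳ (x*x⁻¹≈1 0<x) ⟩
    1# * y             ≈⟨ *-identityˡ y ⟩
    y                  ∎
    where open import Relation.Binary.Reasoning.Setoid setoid

  x*[y/x]≈y : ∀ {x} y → 0# < x → x * (y / x) ≈ y
  x*[y/x]≈y {x} y 0<x = begin
    x * (y / x)        ≈⟨ solve 3 (λ x i y → x :* (y :* i) := (x :* i) :* y) ≈-refl x (x ⁻¹) y ⟩
    x * x ⁻¹ * y       ≈⟨ *-congʳ (x*x⁻¹≈1 0<x) ⟩
    1# * y             ≈⟨ *-identityˡ y ⟩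
    y                  ∎
    where open import Relation.Binary.Reasoning.Setoid setoid

  0≤1/x : ∀ {x} → 0# < x → 0# ≤ 1# / x
  0≤1/x 0<x = 0≤x*y (<⇒≤ 0<1) (<⇒≤ (0<x⁻¹ 0<x))

  fromℕ-* : ∀ m n → fromℕ (m ℕ.* n) ≈ fromℕ m * fromℕ n
  fromℕ-* = ×1-homo-*

  0≤fromℕ : ∀ n → 0# ≤ fromℕ n
  0≤fromℕ zero    = ≤-refl
  0≤fromℕ (suc n) = 0≤x+y (<⇒≤ 0<1) (0≤fromℕ n)

  0<fromℕ[1+n] : ∀ n → 0# < fromℕ (suc n)
  0<fromℕ[1+n] n = 0<x+y 0<1 (0≤fromℕ n)

  0<fromℕ : ∀ {n} → 0 ℕ.< n → 0# < fromℕ n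
  0<fromℕ {suc n} _ = 0<fromℕ[1+n] n

  ∣x∣<ε⁺ : ∀ {x ε} → - ε < x → x < ε → ∣ x ∣ < ε
  ∣x∣<ε⁺ {x} {ε} -ε<x x<ε with x <? 0#
  ... | no  _ = x<ε
  ... | yes _ = <-by-difference (x<y⇒0<y-x -ε<x) (solve 2 (λ x e → x :- :- e := e :- :- x) ≈-refl x ε)

  ∣x∣<ε⇒x<ε : ∀ {x ε} → ∣ x ∣ < ε → x < ε
  ∣x∣<ε⇒x<ε {x} ∣x∣<ε with x <? 0#
  ... | no  _   = ∣x∣<ε
  ... | yes x<0 = <-trans x<0 (<-trans (x<0⇒0<-x x<0) ∣x∣<ε)

  ∣x∣<ε⇒-ε<x : ∀ {x ε} → ∣ x ∣ < ε → - ε < x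
  ∣x∣<ε⇒-ε<x {x} {ε} ∣x∣<ε with x <? 0#
  ... | yes _   = <-by-difference (x<y⇒0<y-x ∣x∣<ε) (solve 2 (λ x e → e :- :- x := x :- :- e) ≈-refl x ε)
  ... | no  x≮0 = <-by-difference (0<x+y (≤-<-trans (≮⇒≥ x≮0) ∣x∣<ε) (≮⇒≥ x≮0))
                    (solve 2 (λ x e → e :+ x := x :- :- e) ≈-refl x ε)

  ∣∣<-cong : ∀ {x y ε} → x ≈ y → ∣ x ∣ < ε → ∣ y ∣ < ε
  ∣∣<-cong x≈y ∣x∣<ε = ∣x∣<ε⁺ (<-respʳ-≈ x≈y (∣x∣<ε⇒-ε<x ∣x∣<ε)) (<-respˡ-≈ x≈y (∣x∣<ε⇒x<ε ∣x∣<ε))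

  ⟶-cong : ∀ {x y : ℕ → Carrier} {L M} → (∀ k → x k ≈ y k) → L ≈ M → x ⟶ L → y ⟶ M
  ⟶-cong x≈y L≈M x⟶L ε 0<ε =
    let (K , close) = x⟶L ε 0<ε in K , λ k K≤k → ∣∣<-cong (+-cong (x≈y k) (-‿cong L≈M)) (close k K≤k)

  -- By contraposition: if x ≤ -ε or ε ≤ x, then x² - ε² is the distance to the nearer endpoint
  -- times that distance plus 2ε, a product of nonnegative factors.
  x²<ε²⇒∣x∣<ε : ∀ {x ε} → 0# < ε → x * x < ε * ε → ∣ x ∣ < ε
  x²<ε²⇒∣x∣<ε {x} {ε} 0<ε x²<ε² = ∣x∣<ε⁺
    (≰⇒> λ x≤-ε → ≤⇒≯ (≤-by-difference
      (0≤x*y (x≤y⇒0≤y-x x≤-ε) (0≤x+y (x≤y⇒0≤y-x x≤-ε) (0≤x+y (<⇒≤ 0<ε) (<⇒≤ 0<ε))))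
      (solve 2 (λ x e → (:- e :- x) :* ((:- e :- x) :+ (e :+ e)) := x :* x :- e :* e) ≈-refl x ε)) x²<ε²)
    (≰⇒> λ ε≤x → ≤⇒≯ (≤-by-difference
      (0≤x*y (x≤y⇒0≤y-x ε≤x) (0≤x+y (x≤y⇒0≤y-x ε≤x) (0≤x+y (<⇒≤ 0<ε) (<⇒≤ 0<ε))))
      (solve 2 (λ x e → (x :- e) :* ((x :- e) :+ (e :+ e)) := x :* x :- e :* e) ≈-refl x ε)) x²<ε²)

  ≤-by-approximation : ∀ {x y} → (∀ ε → 0# < ε → x < y + ε) → x ≤ y
  ≤-by-approximation {x} {y} x<y+ε = ≮⇒≥ λ y<x → <-irrefl ≈-refl
    (<-respʳ-≈ (solve 2 (λ x y → y :+ (x :- y) := x) ≈-refl x y) (x<y+ε (x - y) (x<y⇒0<y-x y<x)))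

  limit-≤ : ∀ {x : ℕ → Carrier} {L u} → x ⟶ L → ∀ K₀ → (∀ k → K₀ ℕ.≤ k → x k ≤ u) → L ≤ u
  limit-≤ {x} {L} {u} x⟶L K₀ x≤u = ≤-by-approximation λ ε 0<ε →
    let (K , close) = x⟶L ε 0<ε
        k = K ℕ.⊔ K₀ in
    <-by-difference (0<x+y (x<y⇒0<y-x (∣x∣<ε⇒-ε<x (close k (ℕ.m≤m⊔n K K₀))))
                           (x≤y⇒0≤y-x (x≤u k (ℕ.m≤n⊔m K K₀))))
      (solve 4 (λ x l u e → ((x :- l) :- :- e) :+ (u :- x) := (u :+ e) :- l) ≈-refl (x k) L u ε)

  limit-≥ : ∀ {x : ℕ → Carrier} {L u} → x ⟶ L → ∀ K₀ → (∀ k → K₀ ℕ.≤ k → u ≤ x k) → u ≤ L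
  limit-≥ {x} {L} {u} x⟶L K₀ u≤x = ≤-by-approximation λ ε 0<ε →
    let (K , close) = x⟶L ε 0<ε
        k = K ℕ.⊔ K₀ in
    <-by-difference (0<x+y (x<y⇒0<y-x (∣x∣<ε⇒x<ε (close k (ℕ.m≤m⊔n K K₀))))
                           (x≤y⇒0≤y-x (u≤x k (ℕ.m≤n⊔m K K₀))))
      (solve 4 (λ x l u e → (e :- (x :- l)) :+ (x :- u) := (l :+ e) :- u) ≈-refl (x k) L u ε)

  limit-eventually-constant : ∀ {x : ℕ → Carrier} {L c} → x ⟶ L → ∀ K₀ → (∀ k → K₀ ℕ.≤ k → x k ≈ c) → L ≈ c
  limit-eventually-constant x⟶L K₀ x≈c = ≤-antisym
    (limit-≤ x⟶L K₀ (λ k K₀≤k → ≤-reflexive (x≈c k K₀≤k)))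
    (limit-≥ x⟶L K₀ (λ k K₀≤k → ≤-reflexive (≈-sym (x≈c k K₀≤k))))

  module _ (em : ExcludedMiddle ℓ) where
    -- Otherwise the naturals have a supremum s. As n + 1 ≤ s for every n, s - 1 is an upper bound
    -- too, against minimality.
    archimedean : ∀ x → ∃ λ n → x < fromℕ n
    archimedean x with em {P = ∃ λ n → x < fromℕ n}
    ... | yes ∃n = ∃n
    ... | no ∄n = contradiction (least (s - 1#) s-1-bound)
                    (λ s≤s-1 → ≤⇒≯ s≤s-1 (<-by-difference 0<1
                      (solve 1 (λ s → con (+ 1) := s :- (s :- con (+ 1))) ≈-refl s)))
      where
      IsNatural : Carrier → Set ℓ
      IsNatural y = ∃ λ n → y ≈ fromℕ n
      supremum = complete IsNatural (0# , 0 , ≈-refl)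
        (x , λ y (n , y≈n) → ≤-respˡ-≈ (≈-sym y≈n) (≮⇒≥ λ x<n → ∄n (n , x<n)))
      s = proj₁ supremum
      least = proj₂ (proj₂ supremum)
      s-1-bound : IsUpperBound IsNatural (s - 1#)
      s-1-bound y (n , y≈n) = ≤-respˡ-≈ (≈-sym y≈n)
        (≤-by-difference (x≤y⇒0≤y-x (proj₁ (proj₂ supremum) (fromℕ (suc n)) (suc n , ≈-refl)))
          (solve 2 (λ s n → s :- (con (+ 1) :+ n) := (s :- con (+ 1)) :- n) ≈-refl s (fromℕ n)))

    x/n<ε : ∀ x ε → 0# < ε → ∃ λ n → x * (fromℕ (suc n)) ⁻¹ < ε
    x/n<ε x ε 0<ε with archimedean (x / ε)
    ... | n , x/ε<n = n , *-cancelˡ-< 0<1+n (begin-strict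
      fromℕ (suc n) * (x / fromℕ (suc n))  ≈⟨ x*[y/x]≈y x 0<1+n ⟩
      x                                    ≈⟨ x*[y/x]≈y x 0<ε ⟨
      ε * (x / ε)                          <⟨ *-monoʳ-< 0<ε x/ε<n ⟩
      ε * fromℕ n                          <⟨ *-monoʳ-< 0<ε (<-by-difference 0<1
        (solve 1 (λ n → con (+ 1) := (con (+ 1) :+ n) :- n) ≈-refl (fromℕ n))) ⟩
      ε * fromℕ (suc n)                    ≈⟨ *-comm ε _ ⟩
      fromℕ (suc n) * ε                    ∎)
      where
      open ≤-Reasoning
      0<1+n = 0<fromℕ[1+n] n

-- Finite sums, and sums over all bijections.

module FiniteSums {ℓ} (ℝ : CompleteOrderedField ℓ) where
  open CompleteOrderedField ℝ
  open RealNumbers ℝ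
  open Algebra.Properties.Semiring.Sum semiring public
    using (sum; sum-cong-≋; sum-remove; ∑-distrib-+; ∑-comm; *-distribˡ-sum)
  open import Relation.Binary.Reasoning.Setoid setoid

  module _ {a} {A : Set a} where
    sumOver-cong : ∀ (xs : List A) {f g} → (∀ x → f x ≈ g x) → sumOver xs f ≈ sumOver xs g
    sumOver-cong []       f≈g = ≈-refl
    sumOver-cong (x ∷ xs) f≈g = +-cong (f≈g x) (sumOver-cong xs f≈g)

    sumOver-+ : ∀ (xs : List A) f g → sumOver xs (λ x → f x + g x) ≈ sumOver xs f + sumOver xs g
    sumOver-+ []       f g = ≈-sym (+-identityˡ 0#)
    sumOver-+ (x ∷ xs) f g = ≈-trans (+-congˡ (sumOver-+ xs f g))
      (solve 4 (λ a b c d → (a :+ b) :+ (c :+ d) := (a :+ c) :+ (b :+ d)) ≈-refl (f x) (g x) _ _)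

    sumOver-*ˡ : ∀ (xs : List A) c f → sumOver xs (λ x → c * f x) ≈ c * sumOver xs f
    sumOver-*ˡ []       c f = ≈-sym (zeroʳ c)
    sumOver-*ˡ (x ∷ xs) c f = ≈-trans (+-congˡ (sumOver-*ˡ xs c f)) (≈-sym (distribˡ c (f x) _))

    sumOver-minus : ∀ (xs : List A) f g → sumOver xs (λ x → f x - g x) ≈ sumOver xs f - sumOver xs g
    sumOver-minus []       f g = ≈-sym (-‿inverseʳ 0#)
    sumOver-minus (x ∷ xs) f g = ≈-trans (+-congˡ (sumOver-minus xs f g))
      (solve 4 (λ a b c d → (a :- b) :+ (c :- d) := (a :+ c) :- (b :+ d)) ≈-refl (f x) (g x) _ _)

    sumOver-const : ∀ (xs : List A) c → sumOver xs (const c) ≈ fromℕ (length xs) * c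
    sumOver-const []       c = ≈-sym (zeroˡ c)
    sumOver-const (x ∷ xs) c = ≈-trans (+-congˡ (sumOver-const xs c))
      (solve 2 (λ c l → c :+ l :* c := (con (+ 1) :+ l) :* c) ≈-refl c (fromℕ (length xs)))

    sumOver-mono-≤ : ∀ (xs : List A) {f g} → (∀ x → f x ≤ g x) → sumOver xs f ≤ sumOver xs g
    sumOver-mono-≤ []       f≤g = ≤-refl
    sumOver-mono-≤ (x ∷ xs) f≤g = +-mono-≤ (f≤g x) (sumOver-mono-≤ xs f≤g)

    0≤sumOver : ∀ (xs : List A) {f} → (∀ x → 0# ≤ f x) → 0# ≤ sumOver xs f
    0≤sumOver []       0≤f = ≤-refl
    0≤sumOver (x ∷ xs) 0≤f = 0≤x+y (0≤f x) (0≤sumOver xs 0≤f)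

    sumOver-++ : ∀ (xs ys : List A) f → sumOver (xs ++ ys) f ≈ sumOver xs f + sumOver ys f
    sumOver-++ []       ys f = ≈-sym (+-identityˡ _)
    sumOver-++ (x ∷ xs) ys f = ≈-trans (+-congˡ (sumOver-++ xs ys f)) (≈-sym (+-assoc _ _ _))

    sumOver-tabulate : ∀ {n} (h : Fin n → A) f → sumOver (tabulate h) f ≡ sum (f ∘ h)
    sumOver-tabulate {zero}  h f = ≡.refl
    sumOver-tabulate {suc n} h f = ≡.cong (λ s → f (h zero) + s) (sumOver-tabulate (h ∘ suc) f)

  module _ {a b} {A : Set a} {B : Set b} where
    sumOver-map : ∀ (xs : List A) (h : A → B) f → sumOver (map h xs) f ≡ sumOver xs (f ∘ h)
    sumOver-map []       h f = ≡.refl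
    sumOver-map (x ∷ xs) h f = ≡.cong (λ s → f (h x) + s) (sumOver-map xs h f)

    sumOver-comm : ∀ (xs : List A) (ys : List B) (f : A → B → Carrier) →
      sumOver xs (λ x → sumOver ys (f x)) ≈ sumOver ys (λ y → sumOver xs (λ x → f x y))
    sumOver-comm []       ys f = ≈-sym (≈-trans (sumOver-const ys 0#) (zeroʳ _))
    sumOver-comm (x ∷ xs) ys f = ≈-trans (+-congˡ (sumOver-comm xs ys f)) (≈-sym (sumOver-+ ys (f x) _))

  sumOver-cartesianProductWith : ∀ {a b c} {A : Set a} {B : Set b} {C : Set c} (h : A → B → C) xs ys f →
    sumOver (cartesianProductWith h xs ys) f ≈ sumOver xs (λ x → sumOver ys (λ y → f (h x y)))
  sumOver-cartesianProductWith h []       ys f = ≈-refl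
  sumOver-cartesianProductWith h (x ∷ xs) ys f = ≈-trans (sumOver-++ (map (h x) ys) _ f)
    (+-cong (reflexive (sumOver-map ys (h x) f)) (sumOver-cartesianProductWith h xs ys f))

  sum-minus : ∀ {n} (f g : Fin n → Carrier) → sum (λ i → f i - g i) ≈ sum f - sum g
  sum-minus {zero}  f g = ≈-sym (-‿inverseʳ 0#)
  sum-minus {suc n} f g = ≈-trans (+-congˡ (sum-minus (f ∘ suc) (g ∘ suc)))
    (solve 4 (λ a b c d → (a :- b) :+ (c :- d) := (a :+ c) :- (b :+ d)) ≈-refl (f zero) (g zero) _ _)

  sum-const : ∀ n c → sum {n} (const c) ≈ fromℕ n * c
  sum-const zero    c = ≈-sym (zeroˡ c)
  sum-const (suc n) c = ≈-trans (+-congˡ (sum-const n c))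
    (solve 2 (λ c l → c :+ l :* c := (con (+ 1) :+ l) :* c) ≈-refl c (fromℕ n))

  sum-punchIn : ∀ {n} (f : Fin (suc n) → Carrier) k → sum (f ∘ Fin.punchIn k) ≈ sum f - f k
  sum-punchIn f k = ≈-trans (solve 2 (λ s t → s := (t :+ s) :- t) ≈-refl _ (f k))
                            (+-congʳ (≈-sym (sum-remove f)))

  sum² : ∀ {n} → (Fin n → Fin n → Carrier) → Carrier
  sum² f = sum (λ i → sum (f i))

  -- Removing row and column `k` subtracts their common entry twice; the vanishing of that entry
  -- spares the correction.
  sum²-punchIn : ∀ {n} (f : Fin (suc n) → Fin (suc n) → Carrier) k → f k k ≈ 0# →
    sum² (λ i j → f (Fin.punchIn k i) (Fin.punchIn k j)) ≈ sum² f - sum (f k) - sum (λ i → f i k)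
  sum²-punchIn f k fkk≈0 = begin
    sum² (λ i j → f (Fin.punchIn k i) (Fin.punchIn k j))
      ≈⟨ sum-cong-≋ (λ i → sum-punchIn (f (Fin.punchIn k i)) k) ⟩
    sum (λ i → sum (f (Fin.punchIn k i)) - f (Fin.punchIn k i) k)
      ≈⟨ sum-punchIn (λ i → sum (f i) - f i k) k ⟩
    sum (λ i → sum (f i) - f i k) - (sum (f k) - f k k)
      ≈⟨ +-cong (sum-minus (λ i → sum (f i)) (λ i → f i k)) (-‿cong (+-congˡ (-‿cong fkk≈0))) ⟩
    sum² f - sum (λ i → f i k) - (sum (f k) - 0#)
      ≈⟨ solve 3 (λ t r c → t :- c :- (r :- con (+ 0)) := t :- r :- c) ≈-refl _ _ _ ⟩
    sum² f - sum (f k) - sum (λ i → f i k) ∎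

  sumOver-permutations : ∀ n f →
    sumOver (permutations (suc n)) f ≈ sum (λ j → sumOver (permutations n) (λ ρ → f (insert zero j ρ)))
  sumOver-permutations n f = ≈-trans
    (sumOver-cartesianProductWith (insert zero) (allFin (suc n)) (permutations n) f)
    (reflexive (sumOver-tabulate {n = suc n} Function.id _))

  -- Every point is equally often the image of `i`. In the inductive step, on n + 2 points, the
  -- image `j` of `zero` is excluded, and summing sum f - f j over all `j` leaves n + 1 copies of
  -- sum f.
  sumOver-permutations-point : ∀ n (i : Fin (suc n)) f →
    sumOver (permutations (suc n)) (λ φ → f (φ ⟨$⟩ʳ i)) ≈ fromℕ (n !) * sum f
  sumOver-permutations-point n zero f = begin
    sumOver (permutations (suc n)) (λ φ → f (φ ⟨$⟩ʳ zero))
      ≈⟨ sumOver-permutations n _ ⟩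
    sum (λ j → sumOver (permutations n) (const (f j)))
      ≈⟨ sum-cong-≋ (λ j → ≈-trans (sumOver-const (permutations n) (f j))
           (*-congʳ (reflexive (≡.cong fromℕ (permutations-length n))))) ⟩
    sum (λ j → fromℕ (n !) * f j)
      ≈⟨ *-distribˡ-sum (fromℕ (n !)) f ⟨
    fromℕ (n !) * sum f ∎
  sumOver-permutations-point (suc n) (suc i) f = begin
    sumOver (permutations (suc (suc n))) (λ φ → f (φ ⟨$⟩ʳ suc i))
      ≈⟨ sumOver-permutations (suc n) _ ⟩
    sum (λ j → sumOver (permutations (suc n)) (λ ρ → f (Fin.punchIn j (ρ ⟨$⟩ʳ i))))
      ≈⟨ sum-cong-≋ (λ j → ≈-trans (sumOver-permutations-point n i (f ∘ Fin.punchIn j))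
           (*-congˡ (sum-punchIn f j))) ⟩
    sum (λ j → fromℕ (n !) * (sum f - f j))
      ≈⟨ *-distribˡ-sum (fromℕ (n !)) (λ j → sum f - f j) ⟨
    fromℕ (n !) * sum (λ j → sum f - f j)
      ≈⟨ *-congˡ (≈-trans (sum-minus (const (sum f)) f) (+-congʳ (sum-const (suc (suc n)) (sum f)))) ⟩
    fromℕ (n !) * (fromℕ (suc (suc n)) * sum f - sum f)
      ≈⟨ solve 3 (λ p l s → p :* ((con (+ 1) :+ l) :* s :- s) := (l :* p) :* s) ≈-refl
           (fromℕ (n !)) (fromℕ (suc n)) (sum f) ⟩
    fromℕ (suc n) * fromℕ (n !) * sum f
      ≈⟨ *-congʳ (fromℕ-* (suc n) (n !)) ⟨
    fromℕ (suc n !) * sum f ∎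

  -- Two distinct points land equally often on each ordered pair of distinct points; the zero
  -- diagonal lets `sum²` run over all ordered pairs. If neither index is `zero`, row and column of
  -- the image `k` of `zero` are deleted, and summing over the n + 3 values of `k` leaves (n + 3) -
  -- 1 - 1 = n + 1 copies of `sum² f`.
  sumOver-permutations-pair : ∀ n {i j : Fin (suc (suc n))} → i ≢ j → ∀ f → (∀ k → f k k ≈ 0#) →
    sumOver (permutations (suc (suc n))) (λ φ → f (φ ⟨$⟩ʳ i) (φ ⟨$⟩ʳ j)) ≈ fromℕ (n !) * sum² f
  sumOver-permutations-pair n {zero} {zero} 0≢0 f f≈0 = contradiction ≡.refl 0≢0
  sumOver-permutations-pair n {zero} {suc j} _ f f≈0 = begin
    sumOver (permutations (suc (suc n))) (λ φ → f (φ ⟨$⟩ʳ zero) (φ ⟨$⟩ʳ suc j))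
      ≈⟨ sumOver-permutations (suc n) _ ⟩
    sum (λ k → sumOver (permutations (suc n)) (λ ρ → f k (Fin.punchIn k (ρ ⟨$⟩ʳ j))))
      ≈⟨ sum-cong-≋ (λ k → sumOver-permutations-point n j (f k ∘ Fin.punchIn k)) ⟩
    sum (λ k → fromℕ (n !) * sum (f k ∘ Fin.punchIn k))
      ≈⟨ sum-cong-≋ (λ k → *-congˡ {fromℕ (n !)} (≈-trans (sum-punchIn (f k) k) (≈-trans (+-congˡ (-‿cong (f≈0 k))) (x-0≈x _)))) ⟩
    sum (λ k → fromℕ (n !) * sum (f k))
      ≈⟨ *-distribˡ-sum (fromℕ (n !)) (λ k → sum (f k)) ⟨
    fromℕ (n !) * sum² f ∎
  sumOver-permutations-pair n {suc i} {zero} _ f f≈0 =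
    ≈-trans (sumOver-permutations-pair n {zero} {suc i} (λ ()) (λ k l → f l k) f≈0)
            (*-congˡ (∑-comm (λ k l → f l k)))
  sumOver-permutations-pair zero {suc zero} {suc zero} 1≢1 f f≈0 = contradiction ≡.refl 1≢1
  sumOver-permutations-pair (suc n) {suc i} {suc j} 1+i≢1+j f f≈0 = begin
    sumOver (permutations (suc (suc (suc n)))) (λ φ → f (φ ⟨$⟩ʳ suc i) (φ ⟨$⟩ʳ suc j))
      ≈⟨ sumOver-permutations (suc (suc n)) _ ⟩
    sum (λ k → sumOver (permutations (suc (suc n)))
                 (λ ρ → f (Fin.punchIn k (ρ ⟨$⟩ʳ i)) (Fin.punchIn k (ρ ⟨$⟩ʳ j))))
      ≈⟨ sum-cong-≋ (λ k → ≈-trans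
           (sumOver-permutations-pair n (1+i≢1+j ∘ ≡.cong suc)
             (λ l m → f (Fin.punchIn k l) (Fin.punchIn k m)) (λ l → f≈0 (Fin.punchIn k l)))
           (*-congˡ (sum²-punchIn f k (f≈0 k)))) ⟩
    sum (λ k → fromℕ (n !) * (sum² f - sum (f k) - sum (λ l → f l k)))
      ≈⟨ *-distribˡ-sum (fromℕ (n !)) (λ k → sum² f - sum (f k) - sum (λ l → f l k)) ⟨
    fromℕ (n !) * sum (λ k → sum² f - sum (f k) - sum (λ l → f l k))
      ≈⟨ *-congˡ (≈-trans (sum-minus (λ k → sum² f - sum (f k)) (λ k → sum (λ l → f l k)))
           (+-cong (≈-trans (sum-minus (const (sum² f)) (λ k → sum (f k)))
                            (+-congʳ (sum-const (suc (suc (suc n))) (sum² f))))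
                   (-‿cong (∑-comm (λ k l → f l k))))) ⟩
    fromℕ (n !) * (fromℕ (suc (suc (suc n))) * sum² f - sum² f - sum² f)
      ≈⟨ solve 3 (λ p l s → p :* ((con (+ 1) :+ (con (+ 1) :+ l)) :* s :- s :- s) := (l :* p) :* s) ≈-refl
           (fromℕ (n !)) (fromℕ (suc n)) (sum² f) ⟩
    fromℕ (suc n) * fromℕ (n !) * sum² f
      ≈⟨ *-congʳ (fromℕ-* (suc n) (n !)) ⟨
    fromℕ (suc n !) * sum² f ∎

  sum²-symmetric : ∀ n (f : Fin n → Fin n → Carrier) → (∀ i j → f i j ≈ f j i) → (∀ i → f i i ≈ 0#) →
    sum² f ≈ (1# + 1#) * sumOver (pairs n) (λ e → f (lo e) (hi e))
  sum²-symmetric zero    f f-sym f≈0 = ≈-sym (zeroʳ _)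
  sum²-symmetric (suc n) f f-sym f≈0 = begin
    f zero zero + row + sum (λ i → f (suc i) zero + sum (λ j → f (suc i) (suc j)))
      ≈⟨ +-cong (+-congʳ (f≈0 zero)) (∑-distrib-+ (λ i → f (suc i) zero) (λ i → sum (λ j → f (suc i) (suc j)))) ⟩
    0# + row + (sum (λ i → f (suc i) zero) + sum² (λ i j → f (suc i) (suc j)))
      ≈⟨ +-congˡ (+-cong (sum-cong-≋ (λ i → f-sym (suc i) zero))
           (sum²-symmetric n (λ i j → f (suc i) (suc j)) (λ i j → f-sym (suc i) (suc j)) (λ i → f≈0 (suc i)))) ⟩
    0# + row + (row + (1# + 1#) * rest)
      ≈⟨ solve 2 (λ r t → con (+ 0) :+ r :+ (r :+ con (+ 2) :* t) := con (+ 2) :* (r :+ t)) ≈-refl row rest ⟩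
    (1# + 1#) * (row + rest)
      ≈⟨ *-congˡ (≈-trans (sumOver-++ (map (λ j → pair zero (suc j) ℕ.z<s) (allFin n)) _ _)
           (+-cong (reflexive (≡.trans (sumOver-map (allFin n) _ _) (sumOver-tabulate {n = n} Function.id _)))
                   (reflexive (sumOver-map (pairs n) _ _)))) ⟨
    (1# + 1#) * sumOver (pairs (suc n)) (λ e → f (lo e) (hi e)) ∎
    where
    row = sum (λ j → f zero (suc j))
    rest = sumOver (pairs n) (λ e → f (suc (lo e)) (suc (hi e)))

-- Counting pairs.

[1+n]C2≡n+nC2 : ∀ n → suc n C 2 ≡ n ℕ.+ n C 2
[1+n]C2≡n+nC2 n = ≡.trans (≡.sym (nCk+nC[k+1]≡[n+1]C[k+1] n 1)) (≡.cong (ℕ._+ n C 2) (nC1≡n n))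

2*[1+n]C2≡[1+n]*n : ∀ n → 2 ℕ.* (suc n C 2) ≡ suc n ℕ.* n
2*[1+n]C2≡[1+n]*n zero    = ≡.refl
2*[1+n]C2≡[1+n]*n (suc n) = begin
  2 ℕ.* (suc (suc n) C 2)             ≡⟨ ≡.cong (2 ℕ.*_) ([1+n]C2≡n+nC2 (suc n)) ⟩
  2 ℕ.* (suc n ℕ.+ suc n C 2)         ≡⟨ ℕ.*-distribˡ-+ 2 (suc n) _ ⟩
  2 ℕ.* suc n ℕ.+ 2 ℕ.* (suc n C 2)   ≡⟨ ≡.cong (2 ℕ.* suc n ℕ.+_) (2*[1+n]C2≡[1+n]*n n) ⟩
  2 ℕ.* suc n ℕ.+ suc n ℕ.* n         ≡⟨ identity n ⟩
  suc (suc n) ℕ.* suc n               ∎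
  where
  open ≡.≡-Reasoning
  identity : ∀ n → 2 ℕ.* suc n ℕ.+ suc n ℕ.* n ≡ suc (suc n) ℕ.* suc n
  identity = ℕSolver.solve-∀

pairs-length : ∀ n → length (pairs n) ≡ n C 2
pairs-length zero    = ≡.refl
pairs-length (suc n) = begin
  length (pairs (suc n))             ≡⟨ List.length-++ (map (λ j → pair zero (suc j) ℕ.z<s) (allFin n)) ⟩
  length (map (λ j → pair zero (suc j) ℕ.z<s) (allFin n)) ℕ.+ _
    ≡⟨ ≡.cong₂ ℕ._+_ (≡.trans (List.length-map _ (allFin n)) (List.length-tabulate {n = n} Function.id))
                     (≡.trans (List.length-map _ (pairs n)) (pairs-length n)) ⟩
  n ℕ.+ n C 2                        ≡⟨ [1+n]C2≡n+nC2 n ⟨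
  suc n C 2                          ∎
  where open ≡.≡-Reasoning

lo≢hi : ∀ {n} (e : Pair n) → lo e ≢ hi e
lo≢hi (pair i j i<j) i≡j = ⊥-elim-irr (Fin.<⇒≢ i<j i≡j)

-- Alignment strength of fixed graphs.

module AlignmentStrength {ℓ} (ℝ : CompleteOrderedField ℓ) where
  open CompleteOrderedField ℝ
  open RealNumbers ℝ
  open FiniteSums ℝ
  open Alignment ℝ

  2# : Carrier
  2# = 1# + 1#

  0<2# : 0# < 2#
  0<2# = 0<x+y 0<1 (<⇒≤ 0<1)

  0≤𝟙 : ∀ b → 0# ≤ 𝟙 b
  0≤𝟙 true  = <⇒≤ 0<1
  0≤𝟙 false = ≤-refl

  𝟙≤1 : ∀ b → 𝟙 b ≤ 1#
  𝟙≤1 true  = ≤-refl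
  𝟙≤1 false = <⇒≤ 0<1

  -- Affine in the second bit, so that summing over bijections with the first bit fixed needs only
  -- linearity.
  𝟙-xor : ∀ x y → 𝟙 (x xor y) ≈ 𝟙 x + (1# - 2# * 𝟙 x) * 𝟙 y
  𝟙-xor true  true  = solve 0 (con (+ 0) := con (+ 1) :+ (con (+ 1) :- con (+ 2) :* con (+ 1)) :* con (+ 1)) ≈-refl
  𝟙-xor true  false = solve 0 (con (+ 1) := con (+ 1) :+ (con (+ 1) :- con (+ 2) :* con (+ 1)) :* con (+ 0)) ≈-refl
  𝟙-xor false true  = solve 0 (con (+ 1) := con (+ 0) :+ (con (+ 1) :- con (+ 2) :* con (+ 0)) :* con (+ 1)) ≈-refl
  𝟙-xor false false = solve 0 (con (+ 0) := con (+ 0) :+ (con (+ 1) :- con (+ 2) :* con (+ 0)) :* con (+ 0)) ≈-refl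

  density : ∀ {n} → SimpleGraph n → Carrier
  density G = mean (λ e → 𝟙 (edge G e))

  2*pairs≈n*[n-1] : ∀ n → 2# * fromℕ (suc (suc n) C 2) ≈ fromℕ (suc (suc n)) * fromℕ (suc n)
  2*pairs≈n*[n-1] n = begin
    2# * N                                    ≈⟨ *-congʳ (+-congˡ (+-identityʳ 1#)) ⟨
    fromℕ 2 * N                               ≈⟨ fromℕ-* 2 (suc (suc n) C 2) ⟨
    fromℕ (2 ℕ.* (suc (suc n) C 2))           ≡⟨ ≡.cong fromℕ (2*[1+n]C2≡[1+n]*n (suc n)) ⟩
    fromℕ (suc (suc n) ℕ.* suc n)             ≈⟨ fromℕ-* (suc (suc n)) (suc n) ⟩
    fromℕ (suc (suc n)) * fromℕ (suc n)       ∎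
    where
    open import Relation.Binary.Reasoning.Setoid setoid
    N = fromℕ (suc (suc n) C 2)

  0<pairs : ∀ n → 0# < fromℕ (suc (suc n) C 2)
  0<pairs n = *-cancelˡ-< 0<2# (<-respˡ-≈ (≈-sym (zeroʳ 2#)) (<-respʳ-≈ (≈-sym (2*pairs≈n*[n-1] n))
    (*-pos (0<fromℕ[1+n] (suc n)) (0<fromℕ[1+n] n))))

  sumOver-pairs-const : ∀ n c → sumOver (pairs n) (const c) ≈ fromℕ (n C 2) * c
  sumOver-pairs-const n c =
    ≈-trans (sumOver-const (pairs n) c) (*-congʳ (reflexive (≡.cong fromℕ (pairs-length n))))

  mean-cong : ∀ {n} {f g : Pair n → Carrier} → (∀ e → f e ≈ g e) → mean f ≈ mean g
  mean-cong {n} f≈g = *-congˡ (sumOver-cong (pairs n) f≈g)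

  mean-*ˡ : ∀ {n} c (f : Pair n → Carrier) → mean (λ e → c * f e) ≈ c * mean f
  mean-*ˡ {n} c f = ≈-trans (*-congˡ (sumOver-*ˡ (pairs n) c f))
    (solve 3 (λ i c s → i :* (c :* s) := c :* (i :* s)) ≈-refl (1# / fromℕ (n C 2)) c (sumOver (pairs n) f))

  mean-minus : ∀ {n} (f g : Pair n → Carrier) → mean (λ e → f e - g e) ≈ mean f - mean g
  mean-minus {n} f g = ≈-trans (*-congˡ (sumOver-minus (pairs n) f g))
    (solve 3 (λ i s t → i :* (s :- t) := i :* s :- i :* t) ≈-refl (1# / fromℕ (n C 2)) _ _)

  module _ {m : ℕ} where
    private
      n : ℕ
      -- With at least two vertices `N` is positive, so `mean` is a genuine average.
      n = suc (suc m)
      N = fromℕ (n C 2)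

    N*mean≈sum : ∀ f → N * mean {n} f ≈ sumOver (pairs n) f
    N*mean≈sum f = x*[1/x*y]≈y (sumOver (pairs n) f) (0<pairs m)

    mean-const : ∀ c → mean {n} (const c) ≈ c
    mean-const c = *-cancelˡ (0<pairs m) (≈-trans (N*mean≈sum (const c)) (sumOver-pairs-const n c))

    mean-mono-≤ : ∀ {f g} → (∀ e → f e ≤ g e) → mean {n} f ≤ mean g
    mean-mono-≤ f≤g = *-monoʳ-≤ (0≤1/x (0<pairs m)) (sumOver-mono-≤ (pairs n) f≤g)

    mean≤1 : ∀ {f} → (∀ e → f e ≤ 1#) → mean {n} f ≤ 1#
    mean≤1 f≤1 = ≤-respʳ-≈ (mean-const 1#) (mean-mono-≤ f≤1)

    0≤mean : ∀ {f} → (∀ e → 0# ≤ f e) → 0# ≤ mean {n} f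
    0≤mean 0≤f = 0≤x*y (0≤1/x (0<pairs m)) (0≤sumOver (pairs n) 0≤f)

    -- Variance decomposition and total correlation.

    variance+mean² : ∀ p → variance {n} p + mean p * mean p ≈ mean (λ e → p e * p e)
    variance+mean² p = begin
      variance p + μ * μ
        ≈⟨ +-congʳ (mean-cong (λ e → solve 2 (λ p μ → (p :- μ) :* (p :- μ) := p :* p :- μ :* (con (+ 2) :* p :- μ))
             ≈-refl (p e) μ)) ⟩
      mean (λ e → p e * p e - μ * (2# * p e - μ)) + μ * μ
        ≈⟨ +-congʳ (≈-trans (mean-minus (λ e → p e * p e) (λ e → μ * (2# * p e - μ))) (+-congˡ (-‿cong
             (≈-trans (mean-*ˡ μ (λ e → 2# * p e - μ)) (*-congˡ (≈-trans (mean-minus (λ e → 2# * p e) (const μ))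
               (+-cong (mean-*ˡ 2# p) (-‿cong (mean-const μ))))))))) ⟩
      mean (λ e → p e * p e) - μ * (2# * μ - μ) + μ * μ
        ≈⟨ solve 2 (λ s μ → s :- μ :* (con (+ 2) :* μ :- μ) :+ μ :* μ := s) ≈-refl (mean (λ e → p e * p e)) μ ⟩
      mean (λ e → p e * p e) ∎
      where
      open import Relation.Binary.Reasoning.Setoid setoid
      μ = mean p

    -- Law of total variance for the edge indicator at a uniformly random pair: the total μ(1 - μ)
    -- is the mean conditional variance plus the variance of the conditional mean `p`.
    meanBernoulliVariance : ∀ p → mean {n} (λ e → p e * (1# - p e)) ≈ mean p * (1# - mean p) - variance p
    meanBernoulliVariance p = begin
      mean (λ e → p e * (1# - p e))
        ≈⟨ mean-cong (λ e → solve 1 (λ p → p :* (con (+ 1) :- p) := p :- p :* p) ≈-refl (p e)) ⟩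
      mean (λ e → p e - p e * p e)
        ≈⟨ mean-minus p (λ e → p e * p e) ⟩
      mean p - mean (λ e → p e * p e)
        ≈⟨ +-congˡ (-‿cong (variance+mean² p)) ⟨
      mean p - (variance p + mean p * mean p)
        ≈⟨ solve 2 (λ μ v → μ :- (v :+ μ :* μ) := μ :* (con (+ 1) :- μ) :- v) ≈-refl (mean p) (variance p) ⟩
      mean p * (1# - mean p) - variance p ∎
      where open import Relation.Binary.Reasoning.Setoid setoid

    module _ (ϱ : Carrier) (p : Pair n → Carrier) (0<M : 0# < mean p * (1# - mean p)) where
      private
        M = mean p * (1# - mean p)
        v = mean (λ e → p e * (1# - p e))
        ϱT = totalCorrelation ϱ p

      -- By the variance decomposition, M times 1 minus the heterogeneity is `v`. Twice the
      -- right-hand side is the expected proportion of disagreements.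
      M*[1-totalCorrelation] : M * (1# - ϱT) ≈ (1# - ϱ) * v
      M*[1-totalCorrelation] = begin
        M * (1# - ϱT)
          ≈⟨ solve 3 (λ M r h → M :* (con (+ 1) :- (con (+ 1) :- (con (+ 1) :- r) :* (con (+ 1) :- h)))
               := (con (+ 1) :- r) :* (M :- M :* h)) ≈-refl M ϱ (heterogeneity p) ⟩
        (1# - ϱ) * (M - M * heterogeneity p)
          ≈⟨ *-congˡ (+-congˡ (-‿cong (x*[y/x]≈y (variance p) 0<M))) ⟩
        (1# - ϱ) * (M - variance p)
          ≈⟨ *-congˡ (meanBernoulliVariance p) ⟨
        (1# - ϱ) * v ∎
        where open import Relation.Binary.Reasoning.Setoid setoid

      module _ (0≤ϱ : 0# ≤ ϱ) (ϱ≤1 : ϱ ≤ 1#) (0≤p : ∀ e → 0# ≤ p e) (p≤1 : ∀ e → p e ≤ 1#) where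
        private
          0≤v : 0# ≤ v
          0≤v = 0≤mean (λ e → 0≤x*y (0≤p e) (x≤y⇒0≤y-x (p≤1 e)))

          v≤M : v ≤ M
          v≤M = ≤-by-difference (0≤mean (λ e → 0≤x² (p e - mean p)))
            (≈-trans (solve 2 (λ M w → w := M :- (M :- w)) ≈-refl M (variance p))
                     (+-congˡ (-‿cong (≈-sym (meanBernoulliVariance p)))))

        -- This bound and the next place 1 - ϱ_T in [0, 1], so multiplying an error by it does not
        -- enlarge the error.
        0≤1-totalCorrelation : 0# ≤ 1# - ϱT
        0≤1-totalCorrelation = *-cancelˡ-≤ 0<M (≤-respˡ-≈ (≈-sym (zeroʳ M))
          (≤-respʳ-≈ (≈-sym M*[1-totalCorrelation]) (0≤x*y (x≤y⇒0≤y-x ϱ≤1) 0≤v)))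

        1-totalCorrelation≤1 : 1# - ϱT ≤ 1#
        1-totalCorrelation≤1 = *-cancelˡ-≤ 0<M (≤-respˡ-≈ (≈-sym M*[1-totalCorrelation])
          (≤-by-difference (0≤x+y (x≤y⇒0≤y-x v≤M) (0≤x*y 0≤ϱ 0≤v))
            (solve 3 (λ M v r → (M :- v) :+ r :* v := M :* con (+ 1) :- (con (+ 1) :- r) :* v) ≈-refl M v ϱ)))

    -- Average number of disagreements over all bijections.

    sumOver-permutations-edge : ∀ (H : SimpleGraph n) (e : Pair n) →
      sumOver (permutations n) (λ φ → 𝟙 (adj H (φ ⟨$⟩ʳ lo e) (φ ⟨$⟩ʳ hi e)))
        ≈ fromℕ (m !) * (2# * sumOver (pairs n) (λ e → 𝟙 (edge H e)))
    sumOver-permutations-edge H e = ≈-trans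
      (sumOver-permutations-pair m (lo≢hi e) (λ i j → 𝟙 (adj H i j)) diagonal)
      (*-congˡ (sum²-symmetric n (λ i j → 𝟙 (adj H i j)) (λ i j → reflexive (≡.cong 𝟙 (symmetric H i j))) diagonal))
      where
      diagonal : ∀ i → 𝟙 (adj H i i) ≈ 0#
      diagonal i = reflexive (≡.cong 𝟙 (loopless H i))

    n!≈2*N*m! : fromℕ (n !) ≈ 2# * N * fromℕ (m !)
    n!≈2*N*m! = begin
      fromℕ (suc (suc m) ℕ.* (suc m ℕ.* m !))            ≈⟨ fromℕ-* (suc (suc m)) (suc m ℕ.* m !) ⟩
      fromℕ (suc (suc m)) * fromℕ (suc m ℕ.* m !)        ≈⟨ *-congˡ (fromℕ-* (suc m) (m !)) ⟩
      fromℕ (suc (suc m)) * (fromℕ (suc m) * fromℕ (m !)) ≈⟨ *-assoc _ _ _ ⟨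
      fromℕ (suc (suc m)) * fromℕ (suc m) * fromℕ (m !)  ≈⟨ *-congʳ (2*pairs≈n*[n-1] m) ⟨
      2# * N * fromℕ (m !)                               ∎
      where open import Relation.Binary.Reasoning.Setoid setoid

    0<n! : 0# < fromℕ (n !)
    0<n! = 0<fromℕ (ℕ.1≤n! n)

    averageDisagreements≈ : ∀ (G H : SimpleGraph n) →
      averageDisagreements G H ≈ N * (density G + (1# - 2# * density G) * density H)
    averageDisagreements≈ G H = *-cancelˡ 0<n! (begin
      fromℕ (n !) * averageDisagreements G H
        ≈⟨ x*[1/x*y]≈y _ 0<n! ⟩
      sumOver (permutations n) (disagreements G H)
        ≈⟨ sumOver-comm (permutations n) (pairs n) (λ φ e → 𝟙 (edge G e xor adj H (φ ⟨$⟩ʳ lo e) (φ ⟨$⟩ʳ hi e))) ⟩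
      sumOver (pairs n) (λ e → sumOver (permutations n) (λ φ → 𝟙 (edge G e xor adj H (φ ⟨$⟩ʳ lo e) (φ ⟨$⟩ʳ hi e))))
        ≈⟨ sumOver-cong (pairs n) expectation ⟩
      sumOver (pairs n) (λ e → fromℕ (m !) * 2# * h + c * 𝟙 (edge G e))
        ≈⟨ ≈-trans (sumOver-+ (pairs n) (const (fromℕ (m !) * 2# * h)) (λ e → c * 𝟙 (edge G e)))
             (+-cong (sumOver-pairs-const n _) (sumOver-*ˡ (pairs n) c (λ e → 𝟙 (edge G e)))) ⟩
      N * (fromℕ (m !) * 2# * h) + c * g
        ≈⟨ +-cong (*-congˡ (*-congˡ h≈)) (*-cong (+-congˡ (-‿cong (*-congˡ h≈))) g≈) ⟩
      N * (fromℕ (m !) * 2# * (N * density H))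
        + (2# * N * fromℕ (m !) - 2# * (2# * fromℕ (m !)) * (N * density H)) * (N * density G)
        ≈⟨ solve 4 (λ f N x y → N :* (f :* con (+ 2) :* (N :* y))
               :+ (con (+ 2) :* N :* f :- con (+ 2) :* (con (+ 2) :* f) :* (N :* y)) :* (N :* x)
             := con (+ 2) :* N :* f :* (N :* (x :+ (con (+ 1) :- con (+ 2) :* x) :* y)))
             ≈-refl (fromℕ (m !)) N (density G) (density H) ⟩
      2# * N * fromℕ (m !) * (N * (density G + (1# - 2# * density G) * density H))
        ≈⟨ *-congʳ n!≈2*N*m! ⟨
      fromℕ (n !) * (N * (density G + (1# - 2# * density G) * density H)) ∎)
      where
      open import Relation.Binary.Reasoning.Setoid setoid
      g = sumOver (pairs n) (λ e → 𝟙 (edge G e))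
      h = sumOver (pairs n) (λ e → 𝟙 (edge H e))
      g≈ = ≈-sym (N*mean≈sum (λ e → 𝟙 (edge G e)))
      h≈ = ≈-sym (N*mean≈sum (λ e → 𝟙 (edge H e)))
      c = 2# * N * fromℕ (m !) - 2# * (2# * fromℕ (m !)) * h

      -- The right-hand side is arranged as an affine function of the edge bit of G, with `h` and
      -- `c` independent of `e`, so that the outer sum is again linear.
      expectation : ∀ e → sumOver (permutations n) (λ φ → 𝟙 (edge G e xor adj H (φ ⟨$⟩ʳ lo e) (φ ⟨$⟩ʳ hi e)))
                            ≈ fromℕ (m !) * 2# * h + c * 𝟙 (edge G e)
      expectation e = begin
        sumOver (permutations n) (λ φ → 𝟙 (edge G e xor adj H (φ ⟨$⟩ʳ lo e) (φ ⟨$⟩ʳ hi e)))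
          ≈⟨ sumOver-cong (permutations n) (λ φ → 𝟙-xor (edge G e) _) ⟩
        sumOver (permutations n) (λ φ → x + (1# - 2# * x) * 𝟙 (adj H (φ ⟨$⟩ʳ lo e) (φ ⟨$⟩ʳ hi e)))
          ≈⟨ sumOver-+ (permutations n) (const x) _ ⟩
        sumOver (permutations n) (const x)
          + sumOver (permutations n) (λ φ → (1# - 2# * x) * 𝟙 (adj H (φ ⟨$⟩ʳ lo e) (φ ⟨$⟩ʳ hi e)))
          ≈⟨ +-cong (≈-trans (sumOver-const (permutations n) x)
                 (*-congʳ (≈-trans (reflexive (≡.cong fromℕ (permutations-length n))) n!≈2*N*m!)))
               (≈-trans (sumOver-*ˡ (permutations n) (1# - 2# * x) _) (*-congˡ (sumOver-permutations-edge H e))) ⟩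
        2# * N * fromℕ (m !) * x + (1# - 2# * x) * (fromℕ (m !) * (2# * h))
          ≈⟨ solve 4 (λ f N h x → con (+ 2) :* N :* f :* x :+ (con (+ 1) :- con (+ 2) :* x) :* (f :* (con (+ 2) :* h))
               := f :* con (+ 2) :* h :+ (con (+ 2) :* N :* f :- con (+ 2) :* (con (+ 2) :* f) :* h) :* x)
               ≈-refl (fromℕ (m !)) N h x ⟩
        fromℕ (m !) * 2# * h + c * x ∎
        where x = 𝟙 (edge G e)

    -- Two edgeless graphs have x = y = 0 and two complete graphs x = y = 1, and x + y - 2xy
    -- vanishes at both points. This rules out the conventional value of `str`.
    nondegenerate : ∀ {G H : SimpleGraph n} → 0# < averageDisagreements G H →
      ¬ ((Edgeless G × Edgeless H) ⊎ (Complete G × Complete H))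
    nondegenerate {G} {H} 0<avg (inj₁ (G-empty , H-empty)) =
      <⇒≉ 0<avg (≈-trans (averageDisagreements≈ G H) (≈-trans
        (*-congˡ (+-cong (vanish G G-empty) (*-cong (+-congˡ (-‿cong (*-congˡ (vanish G G-empty)))) (vanish H H-empty))))
        (solve 1 (λ N → N :* (con (+ 0) :+ (con (+ 1) :- con (+ 2) :* con (+ 0)) :* con (+ 0)) := con (+ 0)) ≈-refl N)))
      where
      vanish : ∀ (K : SimpleGraph n) → Edgeless K → density K ≈ 0#
      vanish K K-empty = ≈-trans (mean-cong (λ e → reflexive (≡.cong 𝟙 (K-empty (lo e) (hi e))))) (mean-const 0#)
    nondegenerate {G} {H} 0<avg (inj₂ (G-full , H-full)) =
      <⇒≉ 0<avg (≈-trans (averageDisagreements≈ G H) (≈-trans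
        (*-congˡ (+-cong (full G G-full) (*-cong (+-congˡ (-‿cong (*-congˡ (full G G-full)))) (full H H-full))))
        (solve 1 (λ N → N :* (con (+ 1) :+ (con (+ 1) :- con (+ 2) :* con (+ 1)) :* con (+ 1)) := con (+ 0)) ≈-refl N)))
      where
      full : ∀ (K : SimpleGraph n) → Complete K → density K ≈ 1#
      full K K-full = ≈-trans (mean-cong (λ e → reflexive (≡.cong 𝟙 (K-full (lo e) (hi e) (lo≢hi e))))) (mean-const 1#)

  str-nondegenerate : ∀ {n} (G H : SimpleGraph n) φ → ¬ ((Edgeless G × Edgeless H) ⊎ (Complete G × Complete H)) →
    str G H φ ≡ 1# - disagreements G H φ / averageDisagreements G H
  str-nondegenerate G H φ ¬degenerate =
    ≡.cong (λ d → if d then 0# else (1# - disagreements G H φ / averageDisagreements G H)) (dec-false (degenerate? G H) ¬degenerate)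

  -- Perturbation estimate for the alignment strength.

  Within : Carrier → Carrier → Set ℓ
  Within δ x = - δ ≤ x × x ≤ δ

  Within-cong : ∀ {δ x y} → x ≈ y → Within δ x → Within δ y
  Within-cong x≈y (-δ≤x , x≤δ) = ≤-respʳ-≈ x≈y -δ≤x , ≤-respˡ-≈ x≈y x≤δ

  Within-+ : ∀ {δ η x y} → Within δ x → Within η y → Within (δ + η) (x + y)
  Within-+ {δ} {η} (-δ≤x , x≤δ) (-η≤y , y≤η) =
    ≤-respˡ-≈ (solve 2 (λ d h → :- d :- h := :- (d :+ h)) ≈-refl δ η) (+-mono-≤ -δ≤x -η≤y) , +-mono-≤ x≤δ y≤η

  Within-neg : ∀ {δ x} → Within δ x → Within δ (- x)
  Within-neg {δ} {x} (-δ≤x , x≤δ) =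
    ≤-by-difference (x≤y⇒0≤y-x x≤δ) (solve 2 (λ d x → d :- x := :- x :- :- d) ≈-refl δ x) ,
    ≤-by-difference (x≤y⇒0≤y-x -δ≤x) (solve 2 (λ d x → x :- :- d := d :- :- x) ≈-refl δ x)

  -- Twice each slack δ ± xs is a sum of two products of the four nonnegative slacks δ ± x and 1 ±
  -- s, which avoids any case distinction on signs.
  Within-* : ∀ {δ x s} → Within δ x → Within 1# s → Within δ (x * s)
  Within-* {δ} {x} {s} (-δ≤x , x≤δ) (-1≤s , s≤1) =
    *-cancelˡ-≤ 0<2# (≤-by-difference
      (0≤x+y (0≤x*y (x≤y⇒0≤y-x x≤δ) (x≤y⇒0≤y-x s≤1)) (0≤x*y (x≤y⇒0≤y-x -δ≤x) (x≤y⇒0≤y-x -1≤s)))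
      (solve 3 (λ d x s → (d :- x) :* (con (+ 1) :- s) :+ (x :- :- d) :* (s :- :- con (+ 1))
        := con (+ 2) :* (x :* s) :- con (+ 2) :* (:- d)) ≈-refl δ x s)) ,
    *-cancelˡ-≤ 0<2# (≤-by-difference
      (0≤x+y (0≤x*y (x≤y⇒0≤y-x x≤δ) (x≤y⇒0≤y-x -1≤s)) (0≤x*y (x≤y⇒0≤y-x -δ≤x) (x≤y⇒0≤y-x s≤1)))
      (solve 3 (λ d x s → (d :- x) :* (s :- :- con (+ 1)) :+ (x :- :- d) :* (con (+ 1) :- s)
        := con (+ 2) :* d :- con (+ 2) :* (x :* s)) ≈-refl δ x s))

  0≤x≤1⇒Within-1 : ∀ {x} → 0# ≤ x → x ≤ 1# → Within 1# x
  0≤x≤1⇒Within-1 {x} 0≤x x≤1 =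
    ≤-trans (≤-by-difference (<⇒≤ 0<1) (solve 0 (con (+ 1) := con (+ 0) :- :- con (+ 1)) ≈-refl)) 0≤x , x≤1

  0≤x≤1⇒Within-1-2x : ∀ {x} → 0# ≤ x → x ≤ 1# → Within 1# (1# - 2# * x)
  0≤x≤1⇒Within-1-2x {x} 0≤x x≤1 =
    ≤-by-difference (0≤x*y (<⇒≤ 0<2#) (x≤y⇒0≤y-x x≤1))
      (solve 1 (λ x → con (+ 2) :* (con (+ 1) :- x) := con (+ 1) :- con (+ 2) :* x :- :- con (+ 1)) ≈-refl x) ,
    ≤-by-difference (0≤x*y (<⇒≤ 0<2#) 0≤x)
      (solve 1 (λ x → con (+ 2) :* x := con (+ 1) :- (con (+ 1) :- con (+ 2) :* x)) ≈-refl x)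

  ∣x∣<δ⇒Within : ∀ {δ x} → ∣ x ∣ < δ → Within δ x
  ∣x∣<δ⇒Within ∣x∣<δ = <⇒≤ (∣x∣<ε⇒-ε<x ∣x∣<δ) , <⇒≤ (∣x∣<ε⇒x<ε ∣x∣<δ)

  Within-divide : ∀ {δ D ε x} → 0# < D → δ < D * ε → Within δ (D * x) → ∣ x ∣ < ε
  Within-divide {δ} {D} {ε} {x} 0<D δ<Dε (-δ≤Dx , Dx≤δ) = ∣x∣<ε⁺
    (*-cancelˡ-< 0<D (<-by-difference (0<x+y (x<y⇒0<y-x δ<Dε) (x≤y⇒0≤y-x -δ≤Dx))
      (solve 4 (λ d D e x → (D :* e :- d) :+ (D :* x :- :- d) := D :* x :- D :* (:- e)) ≈-refl δ D ε x)))
    (*-cancelˡ-< 0<D (≤-<-trans Dx≤δ δ<Dε))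

  module _ {m : ℕ} (G H : SimpleGraph (suc (suc m))) (ϱ : Carrier) (p : Pair (suc (suc m)) → Carrier)
           (0≤ϱ : 0# ≤ ϱ) (ϱ≤1 : ϱ ≤ 1#) (0≤p : ∀ e → 0# ≤ p e) (p≤1 : ∀ e → p e ≤ 1#)
           {κ δ ε : Carrier} (0<κ : 0# < κ) (κ≤M : κ ≤ mean p * (1# - mean p)) (0<δ : 0# < δ) (0<ε : 0# < ε)
           (2δ≤κ : 2# * δ ≤ κ) (4δ≤κε : 2# * 2# * δ ≤ κ * ε) where
    private
      μ = mean p
      M = μ * (1# - μ)
      x = density G
      y = density H
      z = mean (λ e → 𝟙 (edge G e xor edge H e))
      w = mean (λ e → 2# * ((1# - ϱ) * (p e * (1# - p e))))
      ϱT = totalCorrelation ϱ p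
      N = fromℕ (suc (suc m) C 2)
      D = x + (1# - 2# * x) * y
      d = disagreements G H id
      average = averageDisagreements G H

    -- `D*error` clears the denominator. Its first term is within 2δ of zero, since 1 - ϱ_T lies in
    -- [0, 1], and its second within δ; dividing by `D` then gives an error below ε because 3δ < Dε.
    str-estimate : Within δ (x - μ) → Within δ (y - μ) → Within δ (z - w) → ∣ str G H id - ϱT ∣ < ε
    str-estimate x≈μ y≈μ z≈w =
      Within-divide 0<D 3δ<Dε (Within-cong (≈-sym D*error) (Within-+
        (Within-* D≈2M (0≤x≤1⇒Within-1 (0≤1-totalCorrelation ϱ p 0<M 0≤ϱ ϱ≤1 0≤p p≤1)
                                       (1-totalCorrelation≤1 ϱ p 0<M 0≤ϱ ϱ≤1 0≤p p≤1)))
        (Within-neg z≈w)))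
      where
      0<M : 0# < M
      0<M = <-≤-trans 0<κ κ≤M

      -- Moves from (x, y) to (μ, y) to (μ, μ), where D takes the value 2M. Each move changes one
      -- variable, in which D is affine with slope in [-1, 1].
      D≈2M : Within (δ + δ) (D - 2# * M)
      D≈2M = Within-cong
        (solve 3 (λ x y μ → (x :- μ) :* (con (+ 1) :- con (+ 2) :* y) :+ (y :- μ) :* (con (+ 1) :- con (+ 2) :* μ)
          := x :+ (con (+ 1) :- con (+ 2) :* x) :* y :- con (+ 2) :* (μ :* (con (+ 1) :- μ))) ≈-refl x y μ)
        (Within-+
          (Within-* x≈μ (0≤x≤1⇒Within-1-2x
            (0≤mean (λ e → 0≤𝟙 (edge H e)))
            (mean≤1 (λ e → 𝟙≤1 (edge H e)))))
          (Within-* y≈μ (0≤x≤1⇒Within-1-2x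
            (0≤mean 0≤p) (mean≤1 p≤1))))

      -- D ≥ 2M - 2δ ≥ 2κ - κ.
      κ≤D : κ ≤ D
      κ≤D = ≤-by-difference
        (0≤x+y (0≤x+y (x≤y⇒0≤y-x (proj₁ D≈2M)) (0≤x*y (<⇒≤ 0<2#) (x≤y⇒0≤y-x κ≤M))) (x≤y⇒0≤y-x 2δ≤κ))
        (solve 4 (λ D M d k → (D :- con (+ 2) :* M) :- :- (d :+ d) :+ con (+ 2) :* (M :- k) :+ (k :- con (+ 2) :* d)
          := D :- k) ≈-refl D M δ κ)

      0<D : 0# < D
      0<D = <-≤-trans 0<κ κ≤D

      -- 3δ < 4δ ≤ κε ≤ Dε; the spare δ gives strictness.
      3δ<Dε : (δ + δ) + δ < D * ε
      3δ<Dε = <-by-difference (0<x+y (0<x+y 0<δ (x≤y⇒0≤y-x 4δ≤κε)) (0≤x*y (x≤y⇒0≤y-x κ≤D) (<⇒≤ 0<ε)))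
        (solve 4 (λ d k e D → d :+ (k :* e :- con (+ 2) :* con (+ 2) :* d) :+ (D :- k) :* e
          := D :* e :- (d :+ d :+ d)) ≈-refl δ κ ε D)

      0<average : 0# < average
      0<average = <-respʳ-≈ (≈-sym (averageDisagreements≈ G H)) (*-pos (0<pairs m) 0<D)

      D*[d/average] : D * (d / average) ≈ z
      D*[d/average] = *-cancelˡ (0<pairs m) (begin
        N * (D * (d / average))  ≈⟨ *-assoc N D _ ⟨
        N * D * (d / average)    ≈⟨ *-congʳ (averageDisagreements≈ G H) ⟨
        average * (d / average)  ≈⟨ x*[y/x]≈y d 0<average ⟩
        d                        ≈⟨ N*mean≈sum (λ e → 𝟙 (edge G e xor edge H e)) ⟨
        N * z                    ∎)
        where open import Relation.Binary.Reasoning.Setoid setoid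

      w≈2M[1-ϱT] : w ≈ 2# * (M * (1# - ϱT))
      w≈2M[1-ϱT] = ≈-trans (mean-*ˡ 2# (λ e → (1# - ϱ) * (p e * (1# - p e))))
        (*-congˡ (≈-trans (mean-*ˡ (1# - ϱ) (λ e → p e * (1# - p e)))
        (≈-sym (M*[1-totalCorrelation] ϱ p 0<M))))

      D*error : D * (str G H id - ϱT) ≈ (D - 2# * M) * (1# - ϱT) + - (z - w)
      D*error = begin
        D * (str G H id - ϱT)
          ≡⟨ ≡.cong (λ s → D * (s - ϱT)) (str-nondegenerate G H id (nondegenerate {G = G} {H} 0<average)) ⟩
        D * (1# - d / average - ϱT)
          ≈⟨ solve 3 (λ D q ϱT → D :* (con (+ 1) :- q :- ϱT) := D :* (con (+ 1) :- ϱT) :- D :* q) ≈-refl D (d / average) ϱT ⟩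
        D * (1# - ϱT) - D * (d / average)
          ≈⟨ +-congˡ (-‿cong D*[d/average]) ⟩
        D * (1# - ϱT) - z
          ≈⟨ solve 4 (λ D M S z → D :* S :- z := (D :- con (+ 2) :* M) :* S :+ :- (z :- con (+ 2) :* (M :* S)))
               ≈-refl D M (1# - ϱT) z ⟩
        (D - 2# * M) * (1# - ϱT) + - (z - 2# * (M * (1# - ϱT)))
          ≈⟨ +-congˡ (-‿cong (+-congˡ (-‿cong w≈2M[1-ϱT]))) ⟨
        (D - 2# * M) * (1# - ϱT) + - (z - w) ∎
        where open import Relation.Binary.Reasoning.Setoid setoid

-- Finite additivity, countable subadditivity and the Borel-Cantelli lemma.

module EventProbabilities {ℓ} (em : ExcludedMiddle ℓ) {ℝ : CompleteOrderedField ℓ} (𝒫 : ProbabilitySpace ℝ) where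
  open CompleteOrderedField ℝ
  open RealNumbers ℝ
  open ProbabilitySpace 𝒫

  dne : ∀ {A : Set ℓ} → ¬ ¬ A → A
  dne = em⇒dne em

  Event : Set _
  Event = Pred Ω ℓ

  ∅ : Event
  ∅ = ∁ (const ⊤)

  Measurable-∅ : Measurable ∅
  Measurable-∅ = Measurable-∁ Measurable-Ω

  Measurable-∪ : ∀ {A B : Event} → Measurable A → Measurable B → Measurable (A ∪ B)
  Measurable-∪ {A} {B} A-measurable B-measurable = Measurable-resp
    ((λ { (zero , a) → inj₁ a ; (suc _ , b) → inj₂ b }) , λ { (inj₁ a) → zero , a ; (inj₂ b) → 1 , b })
    (Measurable-⋃ (λ { zero → A ; (suc _) → B }) λ { zero → A-measurable ; (suc _) → B-measurable })

  Measurable-∩ : ∀ {A B : Event} → Measurable A → Measurable B → Measurable (A ∩ B)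
  Measurable-∩ A-measurable B-measurable = Measurable-resp
    ((λ ¬[¬a⊎¬b] → dne (¬[¬a⊎¬b] ∘ inj₁) , dne (¬[¬a⊎¬b] ∘ inj₂)) , λ (a , b) → [ (λ ¬a → ¬a a) , (λ ¬b → ¬b b) ]′)
    (Measurable-∁ (Measurable-∪ (Measurable-∁ A-measurable) (Measurable-∁ B-measurable)))

  Measurable-⋂ : ∀ (A : ℕ → Event) → (∀ k → Measurable (A k)) → Measurable (⋂ ℕ A)
  Measurable-⋂ A A-measurable = Measurable-resp
    ((λ ∄¬a k → dne λ ¬a → ∄¬a (k , ¬a)) , λ a (k , ¬a) → ¬a (a k))
    (Measurable-∁ (Measurable-⋃ (∁ ∘ A) (Measurable-∁ ∘ A-measurable)))

  -- Countable additivity for the constant sequence `∅` makes the multiples of ℙ ∅ converge to ℙ ∅.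
  -- If it were positive, take it as the tolerance: after K + 2 terms the partial sum still exceeds
  -- the limit by at least ℙ ∅.
  ℙ-∅ : ℙ ∅ ≈ 0#
  ℙ-∅ = ≤-antisym (≮⇒≥ λ 0<P → ≤⇒≯ (bounded 0<P) 0<P) (ℙ-nonneg Measurable-∅)
    where
    converges : partialSum (const (ℙ ∅)) ⟶ ℙ ∅
    converges = ⟶-cong (λ _ → ≈-refl) (ℙ-cong (proj₂ , λ e → zero , e))
      (ℙ-⋃ (const ∅) (const Measurable-∅) (λ _ (e , _) → ⊥-elim (e tt)))

    nonneg : ∀ k → 0# ≤ partialSum (const (ℙ ∅)) k
    nonneg zero    = ≤-refl
    nonneg (suc k) = 0≤x+y (nonneg k) (ℙ-nonneg Measurable-∅)

    bounded : 0# < ℙ ∅ → ℙ ∅ ≤ 0#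
    bounded 0<P =
      let (K , close) = converges (ℙ ∅) 0<P in
      ⊥-elim (≤⇒≯ (≤-by-difference (nonneg K)
        (solve 2 (λ s q → s := (s :+ q :+ q :- q) :- q) ≈-refl (partialSum (const (ℙ ∅)) K) (ℙ ∅)))
        (∣x∣<ε⇒x<ε (close (suc (suc K)) (ℕ.m≤n+m K 2))))

  -- Countable additivity with the sequence padded by `∅`: the partial sums are constant from index
  -- 2 on.
  ℙ-∪ : ∀ {A B : Event} → Measurable A → Measurable B → A ⊥ B → ℙ (A ∪ B) ≈ ℙ A + ℙ B
  ℙ-∪ {A} {B} A-measurable B-measurable A⊥B = ≈-trans
    (ℙ-cong ((λ { (inj₁ a) → 0 , a ; (inj₂ b) → 1 , b }) ,
             λ { (0 , a) → inj₁ a ; (1 , b) → inj₂ b ; (suc (suc _) , e) → ⊥-elim (e tt) }))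
    (limit-eventually-constant
      (ℙ-⋃ F (λ { 0 → A-measurable ; 1 → B-measurable ; (suc (suc _)) → Measurable-∅ }) disjoint)
      2 λ { (suc (suc k)) _ → partialSum-F k ; (suc zero) (ℕ.s≤s ()) })
    where
    F : ℕ → Event
    F 0             = A
    F 1             = B
    F (suc (suc _)) = ∅

    disjoint : ∀ {k m} → k ≢ m → F k ⊥ F m
    disjoint {0} {0} 0≢0 _ = ⊥-elim (0≢0 ≡.refl)
    disjoint {0} {1} _ (a , b) = ⊥-elim (A⊥B (a , b))
    disjoint {1} {0} _ (b , a) = ⊥-elim (A⊥B (a , b))
    disjoint {1} {1} 1≢1 _ = ⊥-elim (1≢1 ≡.refl)
    disjoint {suc (suc _)} _ (e , _) = ⊥-elim (e tt)
    disjoint {_} {suc (suc _)} _ (_ , e) = ⊥-elim (e tt)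

    partialSum-F : ∀ k → partialSum (ℙ ∘ F) (suc (suc k)) ≈ ℙ A + ℙ B
    partialSum-F zero    = +-congʳ (+-identityˡ (ℙ A))
    partialSum-F (suc k) = ≈-trans (+-cong (partialSum-F k) ℙ-∅) (+-identityʳ _)

  ℙ-split : ∀ {A C : Event} → Measurable A → Measurable C → ℙ A ≈ ℙ (A ∩ C) + ℙ (A ∩ ∁ C)
  ℙ-split {A} {C} A-measurable C-measurable = ≈-trans (ℙ-cong (split , merge))
    (ℙ-∪ (Measurable-∩ A-measurable C-measurable) (Measurable-∩ A-measurable (Measurable-∁ C-measurable))
         (λ ((_ , c) , (_ , ¬c)) → ¬c c))
    where
    split : A ⊆ (A ∩ C) ∪ (A ∩ ∁ C)
    split {ω} a with em {P = C ω}
    ... | yes c = inj₁ (a , c)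
    ... | no ¬c = inj₂ (a , ¬c)
    merge : (A ∩ C) ∪ (A ∩ ∁ C) ⊆ A
    merge = [ proj₁ , proj₁ ]′

  ℙ-mono : ∀ {A B : Event} → Measurable A → Measurable B → A ⊆ B → ℙ A ≤ ℙ B
  ℙ-mono {A} {B} A-measurable B-measurable A⊆B = ≤-by-difference
    (ℙ-nonneg (Measurable-∩ B-measurable (Measurable-∁ A-measurable)))
    (≈-trans (solve 2 (λ a r → r := (a :+ r) :- a) ≈-refl (ℙ A) _)
      (+-congʳ (≈-sym (≈-trans (ℙ-split B-measurable A-measurable) (+-congʳ (ℙ-cong (proj₂ , λ a → A⊆B a , a)))))))

  module _ (A : ℕ → Event) (A-measurable : ∀ k → Measurable (A k)) where
    private
      before : ℕ → Event
      before zero    = ∅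
      before (suc k) = before k ∪ A k

      -- The usual disjointification: `k` is the least index whose event occurs.
      first : ℕ → Event
      first k = A k ∩ ∁ (before k)

      before-measurable : ∀ k → Measurable (before k)
      before-measurable zero    = Measurable-∅
      before-measurable (suc k) = Measurable-∪ (before-measurable k) (A-measurable k)

      first-measurable : ∀ k → Measurable (first k)
      first-measurable k = Measurable-∩ (A-measurable k) (Measurable-∁ (before-measurable k))

      earlier : ∀ {k m ω} → k ℕ.< m → A k ω → before m ω
      earlier {k} {suc m} k<1+m a with ℕ.m<1+n⇒m<n∨m≡n k<1+m
      ... | inj₁ k<m    = inj₁ (earlier k<m a)
      ... | inj₂ ≡.refl = inj₂ a

      disjoint : ∀ {k m} → k ≢ m → first k ⊥ first m
      disjoint {k} {m} k≢m ((a , ¬before-k) , (a′ , ¬before-m)) with ℕ.<-cmp k m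
      ... | tri< k<m _ _ = ¬before-m (earlier k<m a)
      ... | tri≈ _ k≡m _ = k≢m k≡m
      ... | tri> _ _ m<k = ¬before-k (earlier m<k a′)

      attained : ∀ {ω} k → before k ω → ⋃ ℕ first ω
      attained zero e = ⊥-elim (e tt)
      attained (suc k) (inj₁ b) = attained k b
      attained {ω} (suc k) (inj₂ a) with em {P = before k ω}
      ... | yes b = attained k b
      ... | no ¬b = k , a , ¬b

      partialSum-mono : ∀ K → partialSum (ℙ ∘ first) K ≤ partialSum (ℙ ∘ A) K
      partialSum-mono zero    = ≤-refl
      partialSum-mono (suc K) = +-mono-≤ (partialSum-mono K) (ℙ-mono (first-measurable K) (A-measurable K) proj₁)

    -- The union is also the union of the disjoint events `first`, whose probabilities are dominated
    -- term by term. A bound on all partial sums is used so that the series on the right need not be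
    -- shown to converge.
    ℙ-⋃-≤ : ∀ {u} → (∀ K → partialSum (ℙ ∘ A) K ≤ u) → ℙ (⋃ ℕ A) ≤ u
    ℙ-⋃-≤ bound = ≤-respˡ-≈
      (ℙ-cong ((λ (k , a , _) → k , a) , λ (k , a) → attained (suc k) (inj₂ a)))
      (limit-≤ (ℙ-⋃ first first-measurable disjoint) 0 (λ K _ → ≤-trans (partialSum-mono K) (bound K)))

    ℙ-⋃-null : (∀ k → ℙ (A k) ≈ 0#) → ℙ (⋃ ℕ A) ≈ 0#
    ℙ-⋃-null null = ≤-antisym (ℙ-⋃-≤ (λ K → ≤-reflexive (partialSum-zero K))) (ℙ-nonneg (Measurable-⋃ A A-measurable))
      where
      partialSum-zero : ∀ K → partialSum (ℙ ∘ A) K ≈ 0#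
      partialSum-zero zero    = ≈-refl
      partialSum-zero (suc K) = ≈-trans (+-cong (partialSum-zero K) (null K)) (+-identityʳ 0#)

  -- Later indices are written `j + K`, so that each tail is itself a sequence indexed from 0, ready
  -- for `ℙ-⋃-≤`.
  limsup : (ℕ → Event) → Event
  limsup A = ⋂ ℕ λ K → ⋃ ℕ λ j → A (j ℕ.+ K)

  Measurable-limsup : ∀ (A : ℕ → Event) → (∀ k → Measurable (A k)) → Measurable (limsup A)
  Measurable-limsup A A-measurable = Measurable-⋂ _ λ K → Measurable-⋃ _ λ j → A-measurable (j ℕ.+ K)

  -- The summability hypothesis of the Borel–Cantelli lemma is given by a telescoping majorant.
  borel-cantelli : ∀ (A : ℕ → Event) → (∀ k → Measurable (A k)) →
    (u : ℕ → Carrier) → (∀ k → 0# ≤ u k) → (∀ ε → 0# < ε → ∃ λ k → u k < ε) →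
    (∀ k → ℙ (A k) ≤ u k - u (suc k)) → ℙ (limsup A) ≈ 0#
  borel-cantelli A A-measurable u 0≤u u→0 ℙA≤ = ≤-antisym
    (≤-by-approximation λ ε 0<ε → let (K , uK<ε) = u→0 ε 0<ε in
      ≤-<-trans (≤-trans (ℙ-mono limsup-measurable (Measurable-⋃ _ (λ j → A-measurable (j ℕ.+ K))) (λ often → often K))
                         (tail K))
                (<-respʳ-≈ (≈-sym (+-identityˡ ε)) uK<ε))
    (ℙ-nonneg limsup-measurable)
    where
    limsup-measurable = Measurable-limsup A A-measurable

    telescope : ∀ K j → partialSum (λ j → ℙ (A (j ℕ.+ K))) j ≤ u K - u (j ℕ.+ K)
    telescope K zero    = ≤-reflexive (≈-sym (-‿inverseʳ (u K)))
    telescope K (suc j) = ≤-respʳ-≈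
      (solve 3 (λ a b c → (a :- b) :+ (b :- c) := a :- c) ≈-refl (u K) (u (j ℕ.+ K)) (u (suc j ℕ.+ K)))
      (+-mono-≤ (telescope K j) (ℙA≤ (j ℕ.+ K)))

    tail : ∀ K → ℙ (⋃ ℕ λ j → A (j ℕ.+ K)) ≤ u K
    tail K = ℙ-⋃-≤ (λ j → A (j ℕ.+ K)) (λ j → A-measurable (j ℕ.+ K)) λ j →
      ≤-trans (telescope K j) (≤-by-difference (0≤u (j ℕ.+ K))
        (solve 2 (λ a b → b := a :- (a :- b)) ≈-refl (u K) (u (j ℕ.+ K))))

-- Decidable equality of pairs; their enumeration has no repetitions.

pair-≡ : ∀ {n} {e f : Pair n} → lo e ≡ lo f → hi e ≡ hi f → e ≡ f
pair-≡ ≡.refl ≡.refl = ≡.refl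

_≟ₚ_ : ∀ {n} (e f : Pair n) → Dec (e ≡ f)
e ≟ₚ f = map′ (λ (lo≡ , hi≡) → pair-≡ lo≡ hi≡) (λ e≡f → ≡.cong lo e≡f , ≡.cong hi e≡f)
              ((lo e Fin.≟ lo f) ×-dec (hi e Fin.≟ hi f))

pairs-unique : ∀ n → Unique (pairs n)
pairs-unique zero    = []
pairs-unique (suc n) = Unique.++⁺
  (Unique.map⁺ (λ e≡f → Fin.suc-injective (≡.cong hi e≡f)) (Unique.allFin⁺ n))
  (Unique.map⁺ (λ e≡f → pair-≡ (Fin.suc-injective (≡.cong lo e≡f)) (Fin.suc-injective (≡.cong hi e≡f)))
               (pairs-unique n))
  (λ (e∈ , e∈′) → let (_ , _ , e≡) = ∈-map⁻ _ e∈; (_ , _ , e≡′) = ∈-map⁻ _ e∈′ in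
    Fin.0≢1+n (≡.trans (≡.sym (≡.cong lo e≡)) (≡.cong lo e≡′)))

-- Almost sure statements, and Chebyshev's inequality by revealing one variable at a time.

module LawOfLargeNumbers {ℓ} (em : ExcludedMiddle ℓ) {ℝ : CompleteOrderedField ℓ} (𝒫 : ProbabilitySpace ℝ) where
  open CompleteOrderedField ℝ
  open RealNumbers ℝ
  open ProbabilitySpace 𝒫
  open Probability 𝒫
  open EventProbabilities em 𝒫

  AlmostSurely-mono : ∀ {A B : Event} → A ⊆ B → AlmostSurely A → AlmostSurely B
  AlmostSurely-mono A⊆B (N , N-measurable , ℙN≈0 , off) = N , N-measurable , ℙN≈0 , λ ω ¬Nω → A⊆B (off ω ¬Nω)

  AlmostSurely-⋂ : ∀ (A : ℕ → Event) → (∀ k → AlmostSurely (A k)) → AlmostSurely (⋂ ℕ A)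
  AlmostSurely-⋂ A as =
    ⋃ ℕ (λ k → proj₁ (as k)) , Measurable-⋃ _ (λ k → proj₁ (proj₂ (as k))) ,
    ℙ-⋃-null _ (λ k → proj₁ (proj₂ (as k))) (λ k → proj₁ (proj₂ (proj₂ (as k)))) ,
    λ ω ¬Nω k → proj₂ (proj₂ (proj₂ (as k))) ω (λ Nkω → ¬Nω (k , Nkω))

  AlmostSurely-∁-limsup : ∀ (A : ℕ → Event) → (∀ k → Measurable (A k)) → ℙ (limsup A) ≈ 0# →
    AlmostSurely λ ω → Σ ℕ λ K → ∀ j → ¬ A (j ℕ.+ K) ω
  AlmostSurely-∁-limsup A A-measurable null = limsup A , Measurable-limsup A A-measurable , null , λ ω ¬often →
    dne λ ¬eventually → ¬often λ K → dne λ ¬later → ¬eventually (K , λ j a → ¬later (j , a))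

  module _ {E : Set} (Z : E → Ω → Bool) (Z-measurable : ∀ e → IsDiscreteRandomVariable (Z e)) where
    private
      q : E → Carrier
      q e = ℙ ⟦ Z e ≔ true ⟧

      V : List E → Carrier
      V es = sumOver es (λ e → q e * (1# - q e))

    -- Sequential independence: each variable of the list is independent of `B` intersected with any
    -- prescribed values of the variables before it. The recursion matches that of `chebyshev`.
    IndependentFrom : List E → Event → Set ℓ
    IndependentFrom []       B = ⊤
    IndependentFrom (e ∷ es) B = ∀ z →
      ℙ (B ∩ ⟦ Z e ≔ z ⟧) ≈ ℙ B * ℙ ⟦ Z e ≔ z ⟧ × IndependentFrom es (B ∩ ⟦ Z e ≔ z ⟧)

    deviation : List E → Ω → Carrier
    deviation es ω = sumOver es (λ e → 𝟙 (Z e ω) - ℙ ⟦ Z e ≔ true ⟧)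

    -- `B` records the values already revealed and `c` their contribution to the centred sum; both
    -- are there to make the induction go through.
    Deviates : Carrier → List E → Carrier → Event → Event
    Deviates t es c B ω = B ω × t ≤ (c + deviation es ω) * (c + deviation es ω)

    ℙ-false : ∀ e → ℙ ⟦ Z e ≔ false ⟧ ≈ 1# - q e
    ℙ-false e = ≈-trans (solve 2 (λ q f → f := (q :+ f) :- q) ≈-refl (q e) _) (+-congʳ
      (≈-trans (≈-sym (ℙ-∪ (Z-measurable e true) (Z-measurable e false)
                           (λ (lift z≡true , lift z≡false) → contradiction (≡.trans (≡.sym z≡true) z≡false) λ ())))
               (≈-trans (ℙ-cong ((λ _ → tt) , λ {ω} _ → cases (Z e ω) ≡.refl)) ℙ-Ω)))
      where
      cases : ∀ {ω} z → Z e ω ≡ z → (⟦ Z e ≔ true ⟧ ∪ ⟦ Z e ≔ false ⟧) ω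
      cases true  z≡ = inj₁ (lift z≡)
      cases false z≡ = inj₂ (lift z≡)

    -- Splitting B according to the value of Z e turns the offset c into c + (1 − q) or c − q; the
    -- mean of the two squared offsets is c² + q(1 − q).
    chebyshev : ∀ t es c (B : Event) → Measurable B → IndependentFrom es B →
      Measurable (Deviates t es c B) × t * ℙ (Deviates t es c B) ≤ ℙ B * (c * c + V es)
    -- With nothing left to reveal the centred sum is the constant `c`, so the event is all of `B`
    -- or empty. Markov's inequality is needed only for a constant.
    chebyshev t [] c B B-measurable _ with t ≤? (c + 0#) * (c + 0#)
    ... | yes t≤c² = Measurable-resp B≐ B-measurable ,
      ≤-respˡ-≈ (*-congˡ (ℙ-cong B≐)) (≤-by-difference (0≤x*y (ℙ-nonneg B-measurable) (x≤y⇒0≤y-x t≤c²))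
        (solve 3 (λ b t c → b :* ((c :+ con (+ 0)) :* (c :+ con (+ 0)) :- t) := b :* (c :* c :+ con (+ 0)) :- t :* b)
          ≈-refl (ℙ B) t c))
      where
      B≐ : B ≐ Deviates t [] c B
      B≐ = (λ b → b , t≤c²) , proj₁
    ... | no t≰c² = Measurable-resp ∅≐ Measurable-∅ ,
      ≤-respˡ-≈ (≈-sym (≈-trans (*-congˡ (≈-trans (≈-sym (ℙ-cong ∅≐)) ℙ-∅)) (zeroʳ t)))
        (0≤x*y (ℙ-nonneg B-measurable) (0≤x+y (0≤x² c) ≤-refl))
      where
      ∅≐ : ∅ ≐ Deviates t [] c B
      ∅≐ = (λ e → ⊥-elim (e tt)) , λ (_ , t≤c²) → ⊥-elim (t≰c² t≤c²)
    chebyshev t (e ∷ es) c B B-measurable independent =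
      -- Measurability travels in the same induction because additivity of ℙ requires it of both
      -- pieces.
      Measurable-resp pieces (Measurable-∪ (measurable true) (measurable false)) ,
      (begin
        t * ℙ (Deviates t (e ∷ es) c B)
          ≈⟨ *-congˡ (≈-trans (≈-sym (ℙ-cong pieces)) (ℙ-∪ (measurable true) (measurable false)
               λ (((_ , lift z≡true) , _) , ((_ , lift z≡false) , _)) →
                 contradiction (≡.trans (≡.sym z≡true) z≡false) λ ())) ⟩
        t * (ℙ (piece true) + ℙ (piece false))
          ≈⟨ distribˡ t _ _ ⟩
        t * ℙ (piece true) + t * ℙ (piece false)
          ≤⟨ +-mono-≤ (bound true) (bound false) ⟩
        ℙ (B ∩ ⟦ Z e ≔ true ⟧) * (offset true * offset true + V es)
          + ℙ (B ∩ ⟦ Z e ≔ false ⟧) * (offset false * offset false + V es)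
          ≈⟨ +-cong (*-congʳ (proj₁ (independent true)))
                    (*-congʳ (≈-trans (proj₁ (independent false)) (*-congˡ (ℙ-false e)))) ⟩
        ℙ B * q e * (offset true * offset true + V es)
          + ℙ B * (1# - q e) * (offset false * offset false + V es)
          ≈⟨ solve 4 (λ b q c v →
               b :* q :* ((c :+ (con (+ 1) :- q)) :* (c :+ (con (+ 1) :- q)) :+ v)
                 :+ b :* (con (+ 1) :- q) :* ((c :+ (con (+ 0) :- q)) :* (c :+ (con (+ 0) :- q)) :+ v)
               := b :* (c :* c :+ (q :* (con (+ 1) :- q) :+ v))) ≈-refl (ℙ B) (q e) c (V es) ⟩
        ℙ B * (c * c + V (e ∷ es)) ∎)
      where
      open ≤-Reasoning
      offset : Bool → Carrier
      offset z = c + (𝟙 z - q e)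

      piece : Bool → Event
      piece z = Deviates t es (offset z) (B ∩ ⟦ Z e ≔ z ⟧)

      hypothesis : ∀ z → Measurable (piece z) ×
        t * ℙ (piece z) ≤ ℙ (B ∩ ⟦ Z e ≔ z ⟧) * (offset z * offset z + V es)
      hypothesis z = chebyshev t es (offset z) (B ∩ ⟦ Z e ≔ z ⟧)
        (Measurable-∩ B-measurable (Z-measurable e z)) (proj₂ (independent z))

      measurable : ∀ z → Measurable (piece z)
      measurable z = proj₁ (hypothesis z)

      bound : ∀ z → t * ℙ (piece z) ≤ ℙ (B ∩ ⟦ Z e ≔ z ⟧) * (offset z * offset z + V es)
      bound z = proj₂ (hypothesis z)

      recentre : ∀ {z ω} → Z e ω ≡ z →
        (offset z + deviation es ω) * (offset z + deviation es ω)
          ≈ (c + deviation (e ∷ es) ω) * (c + deviation (e ∷ es) ω)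
      recentre {ω = ω} ≡.refl = *-cong (+-assoc c _ _) (+-assoc c _ _)

      pieces : piece true ∪ piece false ≐ Deviates t (e ∷ es) c B
      pieces = [ merge , merge ]′ , λ {ω} → split (Z e ω) ≡.refl
        where
        merge : ∀ {z} → piece z ⊆ Deviates t (e ∷ es) c B
        merge ((b , lift z≡) , far) = b , ≤-respʳ-≈ (recentre z≡) far
        split : ∀ {ω} z → Z e ω ≡ z → Deviates t (e ∷ es) c B ω → (piece true ∪ piece false) ω
        split true  z≡ (b , far) = inj₁ ((b , lift z≡) , ≤-respʳ-≈ (≈-sym (recentre z≡)) far)
        split false z≡ (b , far) = inj₂ ((b , lift z≡) , ≤-respʳ-≈ (≈-sym (recentre z≡)) far)

  -- From product-form to sequential independence.

  productOver-cong : ∀ {a} {A : Set a} {xs : List A} {f g} → All (λ x → f x ≈ g x) xs → productOver xs f ≈ productOver xs g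
  productOver-cong []            = ≈-refl
  productOver-cong (f≈g ∷ fs≈gs) = *-cong f≈g (productOver-cong fs≈gs)

  -- Replaces the one factor at `y`, equal to 1 in the product of `f`, by `g y`; uniqueness ensures
  -- that it occurs once.
  productOver-update : ∀ {a} {A : Set a} {xs : List A} {y} {f g} → Unique xs → y ∈ xs → f y ≈ 1# →
    (∀ {x} → y ≢ x → f x ≈ g x) → productOver xs g ≈ productOver xs f * g y
  productOver-update {xs = x ∷ xs} {f = f} {g} (x≢xs ∷ _) (here ≡.refl) fx≈1 f≈g = begin
    g x * productOver xs g         ≈⟨ *-congˡ (productOver-cong (All.map f≈g x≢xs)) ⟨
    g x * productOver xs f         ≈⟨ solve 2 (λ g p → g :* p := con (+ 1) :* p :* g) ≈-refl (g x) (productOver xs f) ⟩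
    1# * productOver xs f * g x    ≈⟨ *-congʳ (*-congʳ fx≈1) ⟨
    f x * productOver xs f * g x   ∎
    where open import Relation.Binary.Reasoning.Setoid setoid
  productOver-update {xs = x ∷ xs} (x≢xs ∷ unique) (there y∈xs) fy≈1 f≈g = ≈-trans
    (*-cong (≈-sym (f≈g (λ { ≡.refl → All.lookup x≢xs y∈xs ≡.refl }))) (productOver-update unique y∈xs fy≈1 f≈g))
    (≈-sym (*-assoc _ _ _))

  module _ {n} (Z : Pair n → Ω → Bool) (Z-measurable : ∀ e → IsDiscreteRandomVariable (Z e))
           (independent : Independent Z) where
    private
      cylinder : (Pair n → Bool → Bool) → Event
      cylinder β ω = ∀ e → Lift ℓ (T (β e (Z e ω)))

      -- `Independent` speaks only of families of tests, so the condition that `Z e` takes the value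
      -- `z` is encoded as a test at `e` overriding that of `β`.
      update : (Pair n → Bool → Bool) → Pair n → Bool → Pair n → Bool → Bool
      update β e z e′ z′ = if does (e ≟ₚ e′) then does (z′ Bool.≟ z) else β e′ z′

      update-same : ∀ β e z z′ → update β e z e z′ ≡ does (z′ Bool.≟ z)
      update-same β e z z′ = ≡.cong (if_then does (z′ Bool.≟ z) else β e z′) (dec-true (e ≟ₚ e) ≡.refl)

      update-other : ∀ β e z {e′} → e ≢ e′ → ∀ z′ → update β e z e′ z′ ≡ β e′ z′
      update-other β e z {e′} e≢e′ z′ =
        ≡.cong (if_then does (z′ Bool.≟ z) else β e′ z′) (dec-false (e ≟ₚ e′) e≢e′)

      T-does : ∀ {z z′ : Bool} → T (does (z′ Bool.≟ z)) → z′ ≡ z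
      T-does {z} {z′} t with z′ Bool.≟ z
      ... | yes z′≡z = z′≡z

      does-T : ∀ {z z′ : Bool} → z′ ≡ z → T (does (z′ Bool.≟ z))
      does-T {z} {z′} z′≡z = ≡.subst T (≡.sym (dec-true (z′ Bool.≟ z) z′≡z)) _

      cylinder-update : ∀ β e z → (∀ z′ → β e z′ ≡ true) →
        cylinder β ∩ ⟦ Z e ≔ z ⟧ ≐ cylinder (update β e z)
      cylinder-update β e z free = to , λ c → from c , lift (T-does (≡.subst T (update-same β e z _) (lower (c e))))
        where
        to : cylinder β ∩ ⟦ Z e ≔ z ⟧ ⊆ cylinder (update β e z)
        to {ω} (c , lift z≡) e′ with e ≟ₚ e′
        ... | yes ≡.refl = lift (≡.subst T (≡.sym (update-same β e z (Z e ω))) (does-T z≡))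
        ... | no e≢e′    = lift (≡.subst T (≡.sym (update-other β e z e≢e′ (Z e′ ω))) (lower (c e′)))
        from : cylinder (update β e z) ⊆ cylinder β
        from {ω} c e′ with e ≟ₚ e′
        ... | yes ≡.refl = lift (≡.subst T (≡.sym (free (Z e ω))) _)
        ... | no e≢e′    = lift (≡.subst T (update-other β e z e≢e′ (Z e′ ω)) (lower (c e′)))

      -- The product formulas for `β` and for its update differ only in the factor at `e`, which for
      -- `β` is the probability of the sure event.
      ℙ-cylinder-update : ∀ β e z → e ∈ pairs n → (∀ z′ → β e z′ ≡ true) →
        ℙ (cylinder (update β e z)) ≈ ℙ (cylinder β) * ℙ ⟦ Z e ≔ z ⟧
      ℙ-cylinder-update β e z e∈ free = begin
        ℙ (cylinder (update β e z))
          ≈⟨ independent (update β e z) ⟩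
        productOver (pairs n) (λ e′ → ℙ λ ω → Lift ℓ (T (update β e z e′ (Z e′ ω))))
          ≈⟨ productOver-update (pairs-unique n) e∈
               (≈-trans (ℙ-cong ((λ _ → tt) , λ {ω} _ → lift (≡.subst T (≡.sym (free (Z e ω))) _))) ℙ-Ω)
               (λ e≢e′ → ℙ-cong ((λ {ω} (lift t) → lift (≡.subst T (≡.sym (update-other β e z e≢e′ (Z _ ω))) t)) ,
                                 (λ {ω} (lift t) → lift (≡.subst T (update-other β e z e≢e′ (Z _ ω)) t)))) ⟩
        productOver (pairs n) (λ e′ → ℙ λ ω → Lift ℓ (T (β e′ (Z e′ ω))))
          * ℙ (λ ω → Lift ℓ (T (update β e z e (Z e ω))))
          ≈⟨ *-cong (≈-sym (independent β))
               (ℙ-cong ((λ {ω} (lift t) → lift (T-does (≡.subst T (update-same β e z (Z e ω)) t))) ,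
                        (λ {ω} (lift z≡) → lift (≡.subst T (≡.sym (update-same β e z (Z e ω))) (does-T z≡))))) ⟩
        ℙ (cylinder β) * ℙ ⟦ Z e ≔ z ⟧ ∎
        where open import Relation.Binary.Reasoning.Setoid setoid

      -- The invariant is that `β` accepts every value at the pairs still listed; uniqueness
      -- preserves it when the head receives a test. `B` is a cylinder only up to `≐`, as the
      -- intersections in `IndependentFrom` do not literally have that shape.
      independentFrom-cylinder : ∀ {es} → Unique es → (∀ {e} → e ∈ es → e ∈ pairs n) →
        ∀ β → (∀ {e} → e ∈ es → ∀ z → β e z ≡ true) → ∀ {B} → B ≐ cylinder β → IndependentFrom Z Z-measurable es B
      independentFrom-cylinder [] _ _ _ _ = tt
      independentFrom-cylinder {e ∷ _} (e≢es ∷ unique) es⊆ β free {B} (B⊆ , ⊆B) z =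
        ≈-trans (ℙ-cong B∩≐) (≈-trans (ℙ-cylinder-update β e z (es⊆ (here ≡.refl)) (free (here ≡.refl)))
                                      (*-congʳ (ℙ-cong (⊆B , B⊆)))) ,
        independentFrom-cylinder unique (es⊆ ∘ there) (update β e z)
          (λ e′∈ z′ → ≡.trans (update-other β e z (All.lookup e≢es e′∈) z′) (free (there e′∈) z′)) B∩≐
        where
        B∩≐ : B ∩ ⟦ Z e ≔ z ⟧ ≐ cylinder (update β e z)
        B∩≐ = (λ (b , z≡) → proj₁ (cylinder-update β e z (free (here ≡.refl))) (B⊆ b , z≡)) ,
              λ c → let (c′ , z≡) = proj₂ (cylinder-update β e z (free (here ≡.refl))) c in ⊆B c′ , z≡

    independentFrom-pairs : IndependentFrom Z Z-measurable (pairs n) (const ⊤)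
    independentFrom-pairs = independentFrom-cylinder (pairs-unique n) (λ e∈ → e∈) (λ _ _ → true) (λ _ _ → ≡.refl)
      ((λ _ _ → lift _) , λ _ → tt)

-- Strong law for averages of independent bits over pairs.

module StrongLaw {ℓ} (em : ExcludedMiddle ℓ) {ℝ : CompleteOrderedField ℓ} (𝒫 : ProbabilitySpace ℝ) where
  open CompleteOrderedField ℝ
  open RealNumbers ℝ
  open FiniteSums ℝ
  open AlignmentStrength ℝ
  open Alignment ℝ
  open ProbabilitySpace 𝒫
  open Probability 𝒫
  open EventProbabilities em 𝒫
  open LawOfLargeNumbers em 𝒫

  module _ (Z : ∀ n → Pair n → Ω → Bool)
           (Z-measurable : ∀ k e → IsDiscreteRandomVariable (Z (suc (suc k)) e))
           (independent : ∀ k → Independent (Z (suc (suc k)))) where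
    private
      N : ℕ → Carrier
      N k = fromℕ (suc (suc k) C 2)

      centred : ∀ n → Ω → Pair n → Carrier
      centred n ω e = 𝟙 (Z n e ω) - ℙ ⟦ Z n e ≔ true ⟧

      S : ∀ k → Ω → Carrier
      S k = deviation (Z (suc (suc k))) (Z-measurable k) (pairs (suc (suc k)))

      module _ (m : ℕ) where
        -- Only countably many almost sure events can be intersected, so the tolerances run through
        -- 1 / (m + 1).
        M δ : Carrier
        M = fromℕ (suc m)
        δ = M ⁻¹

        0<δ : 0# < δ
        0<δ = 0<x⁻¹ (0<fromℕ[1+n] m)

        -- The threshold belongs to the sum, not to the mean, hence δN, squared.
        Far : ℕ → Event
        Far k = Deviates (Z (suc (suc k))) (Z-measurable k) (δ * N k * (δ * N k)) (pairs (suc (suc k))) 0# (const ⊤)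

        -- The telescoping majorant. With n = k + 2 the Chebyshev bound 2M² / (n(n - 1)) equals 2M²
        -- (1/(k + 1) - 1/(k + 2)).
        u : ℕ → Carrier
        u k = 2# * (M * M) * fromℕ (suc k) ⁻¹

        module _ (k : ℕ) where
          chebyshev-pairs : Measurable (Far k) × _
          chebyshev-pairs = chebyshev (Z (suc (suc k))) (Z-measurable k) (δ * N k * (δ * N k))
            (pairs (suc (suc k))) 0# (const ⊤) Measurable-Ω
            (independentFrom-pairs (Z (suc (suc k))) (Z-measurable k) (independent k))

          -- Each summand satisfies q(1 - q) ≤ 1 since the slack is (1 - q)² + q; this needs only q
          -- ≥ 0, and a sharper constant would not help.
          variances≤N : sumOver (pairs (suc (suc k)))
            (λ e → ℙ ⟦ Z (suc (suc k)) e ≔ true ⟧ * (1# - ℙ ⟦ Z (suc (suc k)) e ≔ true ⟧)) ≤ N k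
          variances≤N = ≤-respʳ-≈ (≈-trans (sumOver-pairs-const (suc (suc k)) 1#) (≈-trans (*-comm _ _) (*-identityˡ _)))
            (sumOver-mono-≤ (pairs (suc (suc k))) λ e →
              ≤-by-difference (0≤x+y (0≤x² (1# - ℙ ⟦ Z (suc (suc k)) e ≔ true ⟧)) (ℙ-nonneg (Z-measurable k e true)))
                (solve 1 (λ q → (con (+ 1) :- q) :* (con (+ 1) :- q) :+ q := con (+ 1) :- q :* (con (+ 1) :- q)) ≈-refl _))

          δ²N*ℙFar≤1 : δ * δ * N k * ℙ (Far k) ≤ 1#
          δ²N*ℙFar≤1 = *-cancelˡ-≤ (0<pairs k) (begin
            N k * (δ * δ * N k * ℙ (Far k))
              ≈⟨ solve 3 (λ n d p → n :* (d :* d :* n :* p) := d :* n :* (d :* n) :* p) ≈-refl (N k) δ (ℙ (Far k)) ⟩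
            δ * N k * (δ * N k) * ℙ (Far k)
              ≤⟨ proj₂ chebyshev-pairs ⟩
            ℙ (const ⊤) * (0# * 0# + _)
              ≈⟨ ≈-trans (*-congʳ ℙ-Ω) (≈-trans (*-identityˡ _) (≈-trans (+-congʳ (zeroˡ 0#)) (+-identityˡ _))) ⟩
            _
              ≤⟨ variances≤N ⟩
            N k
              ≈⟨ ≈-trans (*-comm _ _) (*-identityˡ _) ⟨
            N k * 1# ∎)
            where open ≤-Reasoning

          δ²N*[uₖ-uₖ₊₁]≈1 : δ * δ * N k * (u k - u (suc k)) ≈ 1#
          δ²N*[uₖ-uₖ₊₁]≈1 = begin
            δ * δ * N k * (2# * (M * M) * i - 2# * (M * M) * j)
              ≈⟨ solve 5 (λ d n m i j → d :* d :* n :* (con (+ 2) :* (m :* m) :* i :- con (+ 2) :* (m :* m) :* j)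
                   := (m :* d) :* (m :* d) :* (con (+ 2) :* n) :* (i :- j)) ≈-refl δ (N k) M i j ⟩
            (M * δ) * (M * δ) * (2# * N k) * (i - j)
              ≈⟨ *-congʳ (*-cong (*-cong (x*x⁻¹≈1 (0<fromℕ[1+n] m)) (x*x⁻¹≈1 (0<fromℕ[1+n] m))) (2*pairs≈n*[n-1] k)) ⟩
            1# * 1# * ((1# + a) * a) * (i - j)
              ≈⟨ solve 3 (λ a i j → con (+ 1) :* con (+ 1) :* ((con (+ 1) :+ a) :* a) :* (i :- j)
                   := (con (+ 1) :+ a) :* (a :* i) :- a :* ((con (+ 1) :+ a) :* j)) ≈-refl a i j ⟩
            (1# + a) * (a * i) - a * ((1# + a) * j)
              ≈⟨ +-cong (*-congˡ (x*x⁻¹≈1 (0<fromℕ[1+n] k))) (-‿cong (*-congˡ (x*x⁻¹≈1 (0<fromℕ[1+n] (suc k))))) ⟩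
            (1# + a) * 1# - a * 1#
              ≈⟨ solve 1 (λ a → (con (+ 1) :+ a) :* con (+ 1) :- a :* con (+ 1) := con (+ 1)) ≈-refl a ⟩
            1# ∎
            where
            open import Relation.Binary.Reasoning.Setoid setoid
            a = fromℕ (suc k)
            i = fromℕ (suc k) ⁻¹
            j = fromℕ (suc (suc k)) ⁻¹

          ℙFar≤ : ℙ (Far k) ≤ u k - u (suc k)
          ℙFar≤ = *-cancelˡ-≤ (*-pos (*-pos 0<δ 0<δ) (0<pairs k))
            (≤-respʳ-≈ (≈-sym δ²N*[uₖ-uₖ₊₁]≈1) δ²N*ℙFar≤1)

        0≤u : ∀ k → 0# ≤ u k
        0≤u k = 0≤x*y (0≤x*y (<⇒≤ 0<2#) (0≤x² M)) (<⇒≤ (0<x⁻¹ (0<fromℕ[1+n] k)))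

        eventually-close : AlmostSurely λ ω → Σ ℕ λ K → ∀ j → ¬ Far (j ℕ.+ K) ω
        eventually-close = AlmostSurely-∁-limsup Far (λ k → proj₁ (chebyshev-pairs k))
          (borel-cantelli Far (λ k → proj₁ (chebyshev-pairs k)) u 0≤u (x/n<ε em (2# * (M * M))) ℙFar≤)

        close : ∀ k {ω} → ¬ Far k ω → ∣ mean (centred (suc (suc k)) ω) ∣ < δ
        close k {ω} ¬far = ∣x∣<ε⁺
          (*-cancelˡ-< (0<pairs k) (<-respˡ-≈ (solve 2 (λ d n → :- (d :* n) := n :* :- d) ≈-refl δ (N k))
            (<-respʳ-≈ S≈ (∣x∣<ε⇒-ε<x ∣S∣<δN))))
          (*-cancelˡ-< (0<pairs k) (<-respʳ-≈ (*-comm δ (N k)) (<-respˡ-≈ S≈ (∣x∣<ε⇒x<ε ∣S∣<δN))))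
          where
          ∣S∣<δN : ∣ 0# + S k ω ∣ < δ * N k
          ∣S∣<δN = x²<ε²⇒∣x∣<ε (*-pos 0<δ (0<pairs k)) (≰⇒> λ far → ¬far (tt , far))
          S≈ : 0# + S k ω ≈ N k * mean (centred (suc (suc k)) ω)
          S≈ = ≈-trans (+-identityˡ _) (≈-sym (N*mean≈sum (centred (suc (suc k)) ω)))

    strong-law : AlmostSurely λ ω → (λ n → mean (λ e → 𝟙 (Z n e ω) - ℙ ⟦ Z n e ≔ true ⟧)) ⟶ 0#
    strong-law = AlmostSurely-mono converges (AlmostSurely-⋂ _ eventually-close)
      where
      converges : ∀ {ω} → (∀ m → Σ ℕ λ K → ∀ j → ¬ Far m (j ℕ.+ K) ω) → (λ n → mean (centred n ω)) ⟶ 0#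
      converges {ω} eventually ε 0<ε with x/n<ε em 1# ε 0<ε
      ... | m , 1/m<ε with eventually m
      -- `Far m k` concerns n = k + 2, whence the threshold is shifted by two; `k` is rewritten as
      -- (k ∸ K) + K to match the indexing of tails.
      ... | K , ¬far = suc (suc K) , λ { (suc (suc k)) (ℕ.s≤s (ℕ.s≤s K≤k)) → <-trans
        (∣∣<-cong (≈-sym (x-0≈x _))
          (close m k (≡.subst (λ k → ¬ Far m k ω) (ℕ.m∸n+n≡m K≤k) (¬far (k ℕ.∸ K)))))
        (<-respˡ-≈ (*-identityˡ (δ m)) 1/m<ε) }

  -- Joint law of two random bits.

  ℙ-⟦,⟧ : ∀ {X Y : Ω → Bool} x y → ℙ ⟦ < X , Y > ≔ (x , y) ⟧ ≈ ℙ (⟦ X ≔ x ⟧ ∩ ⟦ Y ≔ y ⟧)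
  ℙ-⟦,⟧ x y = ℙ-cong ((λ { (lift ≡.refl) → lift ≡.refl , lift ≡.refl }) , λ { (lift ≡.refl , lift ≡.refl) → lift ≡.refl })

  module _ {X Y : Ω → Bool} (X-measurable : IsDiscreteRandomVariable X) (Y-measurable : IsDiscreteRandomVariable Y) where

    ℙ-marginal : ∀ x → ℙ ⟦ X ≔ x ⟧ ≈ ℙ (⟦ X ≔ x ⟧ ∩ ⟦ Y ≔ true ⟧) + ℙ (⟦ X ≔ x ⟧ ∩ ⟦ Y ≔ false ⟧)
    ℙ-marginal x = ≈-trans (ℙ-split (X-measurable x) (Y-measurable true)) (+-congˡ (ℙ-cong
      ((λ { {ω} (x≡ , ≢true) → x≡ , ≢true⇒false (Y ω) ≡.refl ≢true }) ,
       λ { (x≡ , lift ≡false) → x≡ , λ (lift ≡true) → contradiction (≡.trans (≡.sym ≡true) ≡false) λ () })))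
      where
      ≢true⇒false : ∀ {ω} y → Y ω ≡ y → ∁ ⟦ Y ≔ true ⟧ ω → ⟦ Y ≔ false ⟧ ω
      ≢true⇒false true  Y≡ ≢true = ⊥-elim (≢true (lift Y≡))
      ≢true⇒false false Y≡ _     = lift Y≡

    xor-true : (⟦ X ≔ true ⟧ ∩ ⟦ Y ≔ false ⟧) ∪ (⟦ X ≔ false ⟧ ∩ ⟦ Y ≔ true ⟧) ≐ ⟦ (λ ω → X ω xor Y ω) ≔ true ⟧
    xor-true = [ (λ (lift X≡ , lift Y≡) → lift (≡.cong₂ _xor_ X≡ Y≡)) ,
                 (λ (lift X≡ , lift Y≡) → lift (≡.cong₂ _xor_ X≡ Y≡)) ]′ ,
               λ { {ω} (lift xor≡) → cases (X ω) (Y ω) ≡.refl ≡.refl xor≡ }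
      where
      cases : ∀ {ω} x y → X ω ≡ x → Y ω ≡ y → X ω xor Y ω ≡ true →
        ((⟦ X ≔ true ⟧ ∩ ⟦ Y ≔ false ⟧) ∪ (⟦ X ≔ false ⟧ ∩ ⟦ Y ≔ true ⟧)) ω
      cases true  false X≡ Y≡ _ = inj₁ (lift X≡ , lift Y≡)
      cases false true  X≡ Y≡ _ = inj₂ (lift X≡ , lift Y≡)
      cases true  true  X≡ Y≡ xor≡ = contradiction (≡.trans (≡.sym xor≡) (≡.cong₂ _xor_ X≡ Y≡)) λ ()
      cases false false X≡ Y≡ xor≡ = contradiction (≡.trans (≡.sym xor≡) (≡.cong₂ _xor_ X≡ Y≡)) λ ()

    xor-measurable : IsDiscreteRandomVariable (λ ω → X ω xor Y ω)
    xor-measurable true = Measurable-resp xor-true (Measurable-∪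
      (Measurable-∩ (X-measurable true) (Y-measurable false)) (Measurable-∩ (X-measurable false) (Y-measurable true)))
    xor-measurable false = Measurable-resp
      ((λ {ω} ≢true → cases (X ω xor Y ω) ≡.refl ≢true) ,
       λ (lift ≡false) (lift ≡true) → contradiction (≡.trans (≡.sym ≡true) ≡false) λ ())
      (Measurable-∁ (xor-measurable true))
      where
      cases : ∀ {ω} z → X ω xor Y ω ≡ z → ¬ ⟦ (λ ω → X ω xor Y ω) ≔ true ⟧ ω → ⟦ (λ ω → X ω xor Y ω) ≔ false ⟧ ω
      cases true  z≡ ≢true = ⊥-elim (≢true (lift z≡))
      cases false z≡ _     = lift z≡

    ℙ-xor : ℙ ⟦ (λ ω → X ω xor Y ω) ≔ true ⟧ ≈ ℙ (⟦ X ≔ true ⟧ ∩ ⟦ Y ≔ false ⟧) + ℙ (⟦ X ≔ false ⟧ ∩ ⟦ Y ≔ true ⟧)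
    ℙ-xor = ≈-trans (≈-sym (ℙ-cong xor-true)) (ℙ-∪
      (Measurable-∩ (X-measurable true) (Y-measurable false)) (Measurable-∩ (X-measurable false) (Y-measurable true))
      λ ((lift ≡true , _) , (lift ≡false , _)) → contradiction (≡.trans (≡.sym ≡true) ≡false) λ ())

-- From Pearson correlation to the probability of a disagreement.

module CorrelatedPairs {ℓ} (em : ExcludedMiddle ℓ) {ℝ : CompleteOrderedField ℓ} (𝒫 : ProbabilitySpace ℝ) where
  open CompleteOrderedField ℝ
  open RealNumbers ℝ
  open AlignmentStrength ℝ
  open ProbabilitySpace 𝒫
  open Probability 𝒫
  open EventProbabilities em 𝒫
  open LawOfLargeNumbers em 𝒫
  open StrongLaw em 𝒫

  -- Identifies the two standard deviations, so that their product becomes the common variance p(1 -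
  -- p) and no square root remains.
  squares-injective : ∀ {x y} → 0# ≤ x → 0# ≤ y → x * x ≈ y * y → x ≈ y
  squares-injective 0≤x 0≤y x²≈y² =
    ≤-antisym (≮⇒≥ (strict 0≤y (≈-sym x²≈y²))) (≮⇒≥ (strict 0≤x x²≈y²))
    where
    strict : ∀ {x y} → 0# ≤ x → x * x ≈ y * y → ¬ (x < y)
    strict {x} {y} 0≤x x²≈y² x<y = <-irrefl x²≈y² (≤-<-trans (*-monoʳ-≤ 0≤x (<⇒≤ x<y))
      (<-respˡ-≈ (*-comm y x) (*-monoʳ-< (≤-<-trans 0≤x x<y) x<y)))

  𝔼≈ℙ : ∀ X → 𝔼[ X ] ≈ ℙ ⟦ X ≔ true ⟧
  𝔼≈ℙ X = solve 2 (λ q r → con (+ 0) :* q :+ (con (+ 1) :* r :+ con (+ 0)) := r) ≈-refl _ _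

  Var-bernoulli : ∀ {X p} → IsDiscreteRandomVariable X → IsBernoulli p X → Var X ≈ p * (1# - p)
  Var-bernoulli {X} {p} X-measurable X-bernoulli = begin
    Var X
      ≈⟨ +-cong (*-cong (*-cong (+-congˡ (-‿cong 𝔼≈p)) (+-congˡ (-‿cong 𝔼≈p)))
                        (≈-trans (ℙ-false (λ (_ : ⊤) → X) (λ _ → X-measurable) tt) (+-congˡ (-‿cong X-bernoulli))))
                (+-congʳ (*-cong (*-cong (+-congˡ (-‿cong 𝔼≈p)) (+-congˡ (-‿cong 𝔼≈p))) X-bernoulli)) ⟩
    (0# - p) * (0# - p) * (1# - p) + ((1# - p) * (1# - p) * p + 0#)
      ≈⟨ solve 1 (λ p → (con (+ 0) :- p) :* (con (+ 0) :- p) :* (con (+ 1) :- p)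
           :+ ((con (+ 1) :- p) :* (con (+ 1) :- p) :* p :+ con (+ 0)) := p :* (con (+ 1) :- p)) ≈-refl p ⟩
    p * (1# - p) ∎
    where
    open import Relation.Binary.Reasoning.Setoid setoid
    𝔼≈p = ≈-trans (𝔼≈ℙ X) X-bernoulli

  module _ {X Y : Ω → Bool} {p ϱ : Carrier}
           (X-measurable : IsDiscreteRandomVariable X) (Y-measurable : IsDiscreteRandomVariable Y)
           (X-bernoulli : IsBernoulli p X) (Y-bernoulli : IsBernoulli p Y) where
    private
      P : Bool → Bool → Carrier
      P x y = ℙ (⟦ X ≔ x ⟧ ∩ ⟦ Y ≔ y ⟧)

      0≤P : ∀ x y → 0# ≤ P x y
      0≤P x y = ℙ-nonneg (Measurable-∩ (X-measurable x) (Y-measurable y))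

      -- Equal marginals leave one unknown in the joint law, `P true true`; this cell and the next
      -- two are expressed through it.
      P₁₀ : P true false ≈ p - P true true
      P₁₀ = ≈-trans (solve 2 (λ a b → b := (a :+ b) :- a) ≈-refl (P true true) _)
        (+-congʳ (≈-trans (≈-sym (ℙ-marginal X-measurable Y-measurable true)) X-bernoulli))

      P₀₁ : P false true ≈ p - P true true
      P₀₁ = ≈-trans (solve 2 (λ a b → b := (a :+ b) :- a) ≈-refl (P true true) _)
        (+-congʳ (≈-trans (≈-sym (≈-trans (ℙ-marginal Y-measurable X-measurable true)
          (+-cong (ℙ-cong (swap , swap)) (ℙ-cong (swap , swap))))) Y-bernoulli))

      P₀₀ : P false false ≈ 1# - p - (p - P true true)
      P₀₀ = ≈-trans (solve 2 (λ a b → b := (a :+ b) :- a) ≈-refl (P false true) _)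
        (+-cong (≈-trans (≈-sym (ℙ-marginal X-measurable Y-measurable false))
          (≈-trans (ℙ-false (λ (_ : ⊤) → X) (λ _ → X-measurable) tt) (+-congˡ (-‿cong X-bernoulli)))) (-‿cong P₀₁))

      P₁₁≤p : P true true ≤ p
      P₁₁≤p = ≤-by-difference (0≤P true false) P₁₀

    Cov≈ : Cov X Y ≈ P true true - p * p
    Cov≈ = begin
      Cov X Y
        ≈⟨ +-cong (*-cong (*-cong (at X-bernoulli) (at Y-bernoulli)) (≈-trans (ℙ-⟦,⟧ false false) P₀₀))
          (+-cong (*-cong (*-cong (at X-bernoulli) (at Y-bernoulli)) (≈-trans (ℙ-⟦,⟧ false true) P₀₁))
          (+-cong (*-cong (*-cong (at X-bernoulli) (at Y-bernoulli)) (≈-trans (ℙ-⟦,⟧ true false) P₁₀))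
          (+-congʳ (*-cong (*-cong (at X-bernoulli) (at Y-bernoulli)) (ℙ-⟦,⟧ true true))))) ⟩
      (0# - p) * (0# - p) * (1# - p - (p - r)) + ((0# - p) * (1# - p) * (p - r)
        + ((1# - p) * (0# - p) * (p - r) + ((1# - p) * (1# - p) * r + 0#)))
        ≈⟨ solve 2 (λ p r → (con (+ 0) :- p) :* (con (+ 0) :- p) :* (con (+ 1) :- p :- (p :- r))
             :+ ((con (+ 0) :- p) :* (con (+ 1) :- p) :* (p :- r)
             :+ ((con (+ 1) :- p) :* (con (+ 0) :- p) :* (p :- r) :+ ((con (+ 1) :- p) :* (con (+ 1) :- p) :* r :+ con (+ 0))))
             := r :- p :* p) ≈-refl p r ⟩
      r - p * p ∎
      where
      open import Relation.Binary.Reasoning.Setoid setoid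
      r = P true true
      at : ∀ {Z} → IsBernoulli p Z → ∀ {c} → c - 𝔼[ Z ] ≈ c - p
      at {Z} Z-bernoulli = +-congˡ (-‿cong (≈-trans (𝔼≈ℙ Z) Z-bernoulli))

    -- If p is 0 or 1 both sides vanish, although the correlation is then undefined.
    covariance : 0# ≤ p → p ≤ 1# → (0# < p → p < 1# → HasPearsonCorrelation X Y ϱ) →
      P true true - p * p ≈ ϱ * (p * (1# - p))
    covariance (inj₂ 0≈p) _ _ = begin
      P true true - p * p   ≈⟨ +-cong (≤-antisym (≤-respʳ-≈ (≈-sym 0≈p) P₁₁≤p) (0≤P true true))
                                      (-‿cong (*-congʳ (≈-sym 0≈p))) ⟩
      0# - 0# * p           ≈⟨ solve 2 (λ p r → con (+ 0) :- con (+ 0) :* p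
                                 := r :* (con (+ 0) :* (con (+ 1) :- p))) ≈-refl p ϱ ⟩
      ϱ * (0# * (1# - p))   ≈⟨ *-congˡ (*-congʳ 0≈p) ⟩
      ϱ * (p * (1# - p))    ∎
      where open import Relation.Binary.Reasoning.Setoid setoid
    covariance (inj₁ _) (inj₂ p≈1) _ = begin
      P true true - p * p
        -- At p = 1 the cell `P false false` equals P true true - p, so its nonnegativity forces
        -- `P true true` to be p.
        ≈⟨ +-congʳ (≤-antisym P₁₁≤p (≤-by-difference (0≤P false false) (≈-trans P₀₀ (≈-trans
             (+-congʳ (+-congʳ (≈-sym p≈1))) (solve 2 (λ p r → p :- p :- (p :- r) := r :- p) ≈-refl p _))))) ⟩
      p - p * p
        ≈⟨ solve 1 (λ p → p :- p :* p := p :* (con (+ 1) :- p)) ≈-refl p ⟩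
      p * (1# - p)
        ≈⟨ *-congˡ (≈-trans (+-congˡ (-‿cong p≈1)) (-‿inverseʳ 1#)) ⟩
      p * 0#
        ≈⟨ solve 2 (λ p r → p :* con (+ 0) := r :* (p :* con (+ 0))) ≈-refl p ϱ ⟩
      ϱ * (p * 0#)
        ≈⟨ *-congˡ (*-congˡ (≈-trans (+-congˡ (-‿cong p≈1)) (-‿inverseʳ 1#))) ⟨
      ϱ * (p * (1# - p)) ∎
      where open import Relation.Binary.Reasoning.Setoid setoid
    covariance (inj₁ 0<p) (inj₁ p<1) correlated with correlated 0<p p<1
    ... | s , t , (0≤s , s²≈Var) , (0≤t , t²≈Var) , ϱ≈ = begin
      P true true - p * p    ≈⟨ Cov≈ ⟨
      -- Cancelling s t in Pearson's quotient is legitimate because s t = p(1 - p) is positive.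
      Cov X Y                ≈⟨ x*[y/x]≈y (Cov X Y) (<-respʳ-≈ (≈-sym st≈v) 0<v) ⟨
      s * t * (Cov X Y / (s * t)) ≈⟨ *-congˡ ϱ≈ ⟨
      s * t * ϱ              ≈⟨ *-comm (s * t) ϱ ⟩
      ϱ * (s * t)            ≈⟨ *-congˡ st≈v ⟩
      ϱ * (p * (1# - p))     ∎
      where
      open import Relation.Binary.Reasoning.Setoid setoid
      0<v : 0# < p * (1# - p)
      0<v = *-pos 0<p (x<y⇒0<y-x p<1)
      s²≈v : s * s ≈ p * (1# - p)
      s²≈v = ≈-trans s²≈Var (Var-bernoulli X-measurable X-bernoulli)
      t²≈v : t * t ≈ p * (1# - p)
      t²≈v = ≈-trans t²≈Var (Var-bernoulli Y-measurable Y-bernoulli)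
      st≈v : s * t ≈ p * (1# - p)
      st≈v = ≈-trans (*-congˡ (≈-sym (squares-injective 0≤s 0≤t (≈-trans s²≈v (≈-sym t²≈v))))) s²≈v

    -- Each of the two discordant cells has probability p - P true true, which is the variance p(1 -
    -- p) minus the covariance.
    ℙ-xor-correlated : 0# ≤ p → p ≤ 1# → (0# < p → p < 1# → HasPearsonCorrelation X Y ϱ) →
      ℙ ⟦ (λ ω → X ω xor Y ω) ≔ true ⟧ ≈ 2# * ((1# - ϱ) * (p * (1# - p)))
    ℙ-xor-correlated 0≤p p≤1 correlated = begin
      ℙ ⟦ (λ ω → X ω xor Y ω) ≔ true ⟧
        ≈⟨ ≈-trans (ℙ-xor X-measurable Y-measurable) (+-cong P₁₀ P₀₁) ⟩
      (p - P true true) + (p - P true true)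
        ≈⟨ solve 2 (λ p r → (p :- r) :+ (p :- r) := con (+ 2) :* (p :* (con (+ 1) :- p) :- (r :- p :* p)))
             ≈-refl p (P true true) ⟩
      2# * (p * (1# - p) - (P true true - p * p))
        ≈⟨ *-congˡ (+-congˡ (-‿cong (covariance 0≤p p≤1 correlated))) ⟩
      2# * (p * (1# - p) - ϱ * (p * (1# - p)))
        ≈⟨ *-congˡ (solve 2 (λ v r → v :- r :* v := (con (+ 1) :- r) :* v) ≈-refl (p * (1# - p)) ϱ) ⟩
      2# * ((1# - ϱ) * (p * (1# - p))) ∎
      where open import Relation.Binary.Reasoning.Setoid setoid

theorem4 :
    ∀ {ℓ} → ExcludedMiddle ℓ →
    (ℝ : CompleteOrderedField ℓ) (𝒫 : ProbabilitySpace ℝ) →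
    let open CompleteOrderedField ℝ
        open ProbabilitySpace 𝒫
        open Alignment ℝ
        open Probability 𝒫
    in
    (ϱₑ : ℕ → Carrier) (p : ∀ n → Pair n → Carrier) (a b : Carrier) →
    0# < a → a ≤ b → b < 1# →
    (∀ n → 2 ≤ℕ n → a ≤ mean (p n) × mean (p n) ≤ b) →
    (G H : ∀ n → Ω → SimpleGraph n) →
    (∀ n → 2 ≤ℕ n → CorrelatedBernoulliGraphs (ϱₑ n) (p n) (G n) (H n)) →
    AlmostSurely λ ω →
      (λ n → str (G n ω) (H n ω) id - totalCorrelation (ϱₑ n) (p n)) ⟶ 0#
theorem4 em ℝ 𝒫 ϱₑ p a b 0<a a≤b b<1 a≤mean≤b G H correlatedGraphs =
  AlmostSurely-mono converges (AlmostSurely-⋂ Concentrated concentrated)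
  where
  open CompleteOrderedField ℝ
  open RealNumbers ℝ
  open AlignmentStrength ℝ
  open Alignment ℝ
  open ProbabilitySpace 𝒫
  open Probability 𝒫
  open EventProbabilities em 𝒫
  open LawOfLargeNumbers em 𝒫
  open StrongLaw em 𝒫
  open CorrelatedPairs em 𝒫

  2≤2+k : ∀ {k} → 2 ≤ℕ suc (suc k)
  2≤2+k = ℕ.s≤s (ℕ.s≤s ℕ.z≤n)

  module Graphs k = CorrelatedBernoulliGraphs (correlatedGraphs (suc (suc k)) 2≤2+k)

  X Y D : ∀ n → Pair n → Ω → Bool
  X n = randomEdge (G n)
  Y n = randomEdge (H n)
  D n e ω = X n e ω xor Y n e ω

  Concentrates : (∀ n → Pair n → Ω → Bool) → Event
  Concentrates Z ω = (λ n → mean (λ e → 𝟙 (Z n e ω) - ℙ ⟦ Z n e ≔ true ⟧)) ⟶ 0#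

  -- Three statements, stretched to a sequence by repeating the last, so that the countable
  -- `AlmostSurely-⋂` handles them.
  Concentrated : ℕ → Event
  Concentrated 0             = Concentrates X
  Concentrated 1             = Concentrates Y
  Concentrated (suc (suc _)) = Concentrates D

  concentrated : ∀ i → AlmostSurely (Concentrated i)
  -- A test of one bit, or of the xor, is a test of the pair of bits, so independence of the pairs
  -- passes to each of the three families.
  concentrated 0 = strong-law X Graphs.G-measurable (λ k B → Graphs.independent k (λ e → B e ∘ proj₁))
  concentrated 1 = strong-law Y Graphs.H-measurable (λ k B → Graphs.independent k (λ e → B e ∘ proj₂))
  concentrated (suc (suc _)) = strong-law D (λ k e → xor-measurable (Graphs.G-measurable k e) (Graphs.H-measurable k e))
    (λ k B → Graphs.independent k (λ e (x , y) → B e (x xor y)))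

  -- A lower bound for μ(1 - μ) valid for all n at once.
  κ : Carrier
  κ = a * (1# - b)

  0<κ : 0# < κ
  0<κ = *-pos 0<a (x<y⇒0<y-x b<1)

  κ≤μ[1-μ] : ∀ {μ} → a ≤ μ → μ ≤ b → κ ≤ μ * (1# - μ)
  κ≤μ[1-μ] {μ} a≤μ μ≤b = ≤-by-difference
    (0≤x+y (0≤x*y (x≤y⇒0≤y-x a≤μ) (x≤y⇒0≤y-x (≤-trans μ≤b (<⇒≤ b<1)))) (0≤x*y (<⇒≤ 0<a) (x≤y⇒0≤y-x μ≤b)))
    (solve 3 (λ a b μ → (μ :- a) :* (con (+ 1) :- μ) :+ a :* (b :- μ) := μ :* (con (+ 1) :- μ) :- a :* (con (+ 1) :- b))
      ≈-refl a b μ)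

  -- δ = κη / 4 with η = min(ε, 1): then 4δ = κη is at most κε, and 2δ ≤ 4δ ≤ κ.
  tolerance : ∀ ε → 0# < ε → ∃ λ δ → 0# < δ × 2# * δ ≤ κ × 2# * 2# * δ ≤ κ * ε
  tolerance ε 0<ε = κ * η / (2# * 2#) , 0<δ ,
    ≤-trans (≤-by-difference (0≤x*y (<⇒≤ 0<2#) (<⇒≤ 0<δ))
      (solve 1 (λ d → con (+ 2) :* d := con (+ 2) :* con (+ 2) :* d :- con (+ 2) :* d) ≈-refl _))
      (≤-respˡ-≈ (≈-sym 4δ≈κη) (≤-respʳ-≈ (≈-trans (*-comm κ 1#) (*-identityˡ κ)) (*-monoʳ-≤ (<⇒≤ 0<κ) η≤1))) ,
    ≤-respˡ-≈ (≈-sym 4δ≈κη) (*-monoʳ-≤ (<⇒≤ 0<κ) η≤ε)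
    where
    ε∧1 : ∃ λ η → 0# < η × η ≤ ε × η ≤ 1#
    ε∧1 with ≤-total ε 1#
    ... | inj₁ ε≤1 = ε , 0<ε , ≤-refl , ε≤1
    ... | inj₂ 1≤ε = 1# , 0<1 , 1≤ε , ≤-refl
    η = proj₁ ε∧1
    0<η = proj₁ (proj₂ ε∧1)
    η≤ε = proj₁ (proj₂ (proj₂ ε∧1))
    η≤1 = proj₂ (proj₂ (proj₂ ε∧1))
    0<δ : 0# < κ * η / (2# * 2#)
    0<δ = *-pos (*-pos 0<κ 0<η) (0<x⁻¹ (*-pos 0<2# 0<2#))
    4δ≈κη : 2# * 2# * (κ * η / (2# * 2#)) ≈ κ * η
    4δ≈κη = x*[y/x]≈y (κ * η) (*-pos 0<2# 0<2#)

  converges : ∀ {ω} → (∀ i → Concentrated i ω) →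
    (λ n → str (G n ω) (H n ω) id - totalCorrelation (ϱₑ n) (p n)) ⟶ 0#
  converges {ω} concentrates ε 0<ε =
    let (δ , 0<δ , 2δ≤κ , 4δ≤κε) = tolerance ε 0<ε
        (K₀ , X-close) = concentrates 0 δ 0<δ
        (K₁ , Y-close) = concentrates 1 δ 0<δ
        (K₂ , D-close) = concentrates 2 δ 0<δ
        K = K₀ ℕ.⊔ K₁ ℕ.⊔ K₂
    in suc (suc K) , λ { (suc (suc k)) (ℕ.s≤s (ℕ.s≤s K≤k)) →
      let n = suc (suc k)
          module C = Graphs k
          K≤n = ℕ.≤-trans K≤k (ℕ.m≤n+m k 2)
          (a≤μ , μ≤b) = a≤mean≤b n 2≤2+k
          -- The strong law centres at probabilities; here they are replaced by their formula `q`,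
          -- which is `p n` for each graph and 2(1 - ϱₑ)p(1 - p) for disagreements.
          within : ∀ {Z : Pair n → Ω → Bool} {q} → (∀ e → ℙ ⟦ Z e ≔ true ⟧ ≈ q e) →
            ∣ mean (λ e → 𝟙 (Z e ω) - ℙ ⟦ Z e ≔ true ⟧) - 0# ∣ < δ → Within δ (mean (λ e → 𝟙 (Z e ω)) - mean q)
          within {Z} {q} ℙZ≈q close = Within-cong
            (≈-trans (x-0≈x _)
              (≈-trans (mean-cong (λ e → +-congˡ (-‿cong (ℙZ≈q e)))) (mean-minus (λ e → 𝟙 (Z e ω)) q)))
            (∣x∣<δ⇒Within close)
      in ∣∣<-cong (≈-sym (x-0≈x _))
        (str-estimate (G n ω) (H n ω) (ϱₑ n) (p n) C.0≤ϱₑ C.ϱₑ≤1 C.0≤p C.p≤1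
          0<κ (κ≤μ[1-μ] a≤μ μ≤b) 0<δ 0<ε 2δ≤κ 4δ≤κε
          (within C.G-bernoulli (X-close n (ℕ.≤-trans (ℕ.≤-trans (ℕ.m≤m⊔n K₀ K₁) (ℕ.m≤m⊔n _ K₂)) K≤n)))
          (within C.H-bernoulli (Y-close n (ℕ.≤-trans (ℕ.≤-trans (ℕ.m≤n⊔m K₀ K₁) (ℕ.m≤m⊔n _ K₂)) K≤n)))
          (within (λ e → ℙ-xor-correlated (C.G-measurable e) (C.H-measurable e) (C.G-bernoulli e) (C.H-bernoulli e)
                           (C.0≤p e) (C.p≤1 e) (C.correlated e))
                  (D-close n (ℕ.≤-trans (ℕ.m≤n⊔m _ K₂) K≤n)))) }
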